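{- Let $n\ge 2$ and let $G\le S_n$ be fusion controlled. Let $c_0(\mathcal T(G))$ be the number of connected components of $P_0(\mathcal T(G))$, and choose types $T_1,\dots,T_{c_0(\mathcal T(G))}\in\mathcal T(G_0)$ lying in pairwise distinct components, so that every component of $P_0(\mathcal T(G))$ is $C(T_i)$ for exactly one $i$. For each $i$ pick any connected component $C_i$ of $\widetilde P_0(G)$ containing at least one vertex of type $T_i$. Then $$c_0(G)=\sum_{i=1}^{c_0(\mathcal T(G))}\frac{\mu_{T_i}(G)}{\phi(o(T_i))\,k_{C_i}(T_i)}.$$
   Context: All graphs are finite and undirected; components are connected components. For a finite group $G$, $G_0=G\setminus\{1\}$. The proper power graph $P_0(G)$ has vertex set $G_0$, and distinct $x,y\in G_0$ are adjacent iff $x=y^m$ or $y=x^m$ for some $m\in\mathbb N$; $c_0(G)$ is its number of components. For $x\in G_0$ let $[x]=\{y\in G:\langle y\rangle=\langle x\rangle\}$. The proper quotient power graph $\widetilde P_0(G)$ has vertex set $\{[x]:x\in G_0\}$, distinct $[x],[y]$ being adjacent iff some $x'\in[x]$, $y'\in[y]$ are such that one is a positive power of the other. For $\psi\in S_n$ (acting on $\{1,\dots,n\}$), its type $T_\psi$ is the partition of $n$ given by the multiset of lengths of the orbits of $\langle\psi\rangle$ on $\{1,\dots,n\}$ (fixed points count as parts $1$); the type of $[\psi]$ is $T_\psi$ (well defined). A partition $T=[m_1^{t_1},\dots,m_k^{t_k}]$ (distinct parts $m_j$ with multiplicities $t_j$) has order $o(T)=\mathrm{lcm}(m_1,\dots,m_k)$,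 and for $a\in\mathbb N$ its power is $T^a=[(m_1/\gcd(a,m_1))^{t_1\gcd(a,m_1)},\dots,(m_k/\gcd(a,m_k))^{t_k\gcd(a,m_k)}]$ (so $T_{\psi^a}=(T_\psi)^a$). For $G\le S_n$, $\mathcal T(G_0)=\{T_\psi:\psi\in G_0\}$, and the proper power type graph $P_0(\mathcal T(G))$ has vertex set $\mathcal T(G_0)$, distinct $T,T'$ being adjacent iff one is a power of the other; $C(T)$ is its component containing $T$. $\mu_T(G)$ is the number of elements of $G$ of type $T$; $\phi$ is Euler's totient function; for a component $C$ of $\widetilde P_0(G)$, $k_C(T)$ is the number of vertices of $C$ of type $T$. $G\le S_n$ is fusion controlled if for every $\psi\in G$ and $x\in S_n$ with $x^{ -1}\psi x\in G$ there exists $y\in N_{S_n}(G)$ with $x^{ -1}\psi x=y^{ -1}\psi y$. -}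

module Defs where

open import Level using (0ℓ)
open import Algebra.Bundles using (Group)
import Algebra.Properties.Group as GroupProperties
import Algebra.Properties.Monoid.Mult as Mult
open import Data.Fin as Fin using (Fin)
import Data.Fin.Properties as Fin
open import Data.Fin.Permutation as Perm using (Permutation′; _⟨$⟩ʳ_)
open import Data.Integer using (ℤ; +_; +[1+_]; -[1+_])
open import Data.List using (List; []; _∷_; _++_; map; filter; length; lookup; deduplicate; concatMap; replicate; foldr; allFin; upTo; cartesianProductWith)
import Data.List.Membership.DecPropositional as DecMembership
open import Data.List.Membership.Propositional using (_∈_)
open import Data.List.Membership.Propositional.Properties using (∈-allFin; ∈-∃++; ∈-filter⁺; ∈-map⁺; ∈-upTo⁺)
open import Data.List.Properties using (filter-≐; map-cong)
open import Data.List.Relation.Binary.Permutation.Propositional as ↭ using (_↭_; ↭-refl; ↭-sym; ↭-trans; ↭-prep; ↭-reflexive; ↭-isEquivalence)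
import Data.List.Relation.Binary.Permutation.Propositional.Properties as ↭
open import Data.List.Relation.Unary.All as All using (All; []; _∷_)
import Data.List.Relation.Unary.All.Properties as All
open import Data.List.Relation.Unary.Any as Any using (Any; here; there)
import Data.List.Relation.Unary.Any.Properties as Any
open import Data.List.Relation.Unary.Enumerates.Setoid using (IsEnumeration)
open import Data.Nat as ℕ using (ℕ; zero; suc; _+_; _*_; _∸_; _/_; _%_; NonZero)
import Data.Nat.Properties as ℕ
open import Data.Nat.Coprimality using (coprime?; 1-coprimeTo)
open import Data.Nat.Divisibility using (_∣_; ∣-trans; ∣-antisym; ∣m+n∣m⇒∣n; ∣m∣n⇒∣m+n; 0∣⇒≡0; m∣m*n; n∣m*n)
open import Data.Nat.DivMod using (m≡m%n+[m/n]*n; m%n<n; /-congʳ)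
open import Data.Nat.GCD using (gcd; gcd[m,n]∣m; gcd[m,n]∣n; gcd-greatest; gcd[m,n]≢0)
open import Data.Nat.LCM using (lcm; m∣lcm[m,n]; n∣lcm[m,n]; lcm-least)
open import Data.Product using (Σ; ∃; ∃₂; _×_; _,_; proj₁; proj₂)
open import Data.Sum as Sum using (_⊎_; inj₁; inj₂)
open import Function using (_∘_; _on_; _⇔_; flip)
open import Relation.Binary using (DecSetoid; Rel; Decidable; IsEquivalence; _⇒_; _Respects_; _Respects₂_; Symmetric)
import Relation.Binary.Construct.On as On
open import Relation.Binary.Construct.Closure.ReflexiveTransitive using (Star; ε; _◅_; _◅◅_; reverse)
open import Relation.Binary.PropositionalEquality as ≡ using (_≡_; refl; sym; trans; cong; cong₂; subst)
open import Relation.Nullary using (Dec; yes; no; ¬_; contradiction)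
open import Relation.Nullary.Decidable using (map′; _×-dec_; _⊎-dec_; _→-dec_; ¬?)
open import Relation.Unary as Unary using (Pred; _≐_)

------------------------------------------------------------------------
-- Finite sets, as enumerated decidable setoids

record FinSet : Set₁ where
  field
    decSetoid  : DecSetoid 0ℓ 0ℓ

  open DecSetoid decSetoid public
    renaming (refl to ≈-refl; sym to ≈-sym; trans to ≈-trans)

  field
    elements   : List Carrier
    enumerates : IsEnumeration setoid elements

-- The number of ≈-classes; elements may repeat an element up to ≈.
∣_∣ : FinSet → ℕ
∣ X ∣ = length (deduplicate _≟_ elements)
  where open FinSet X

∣∣-nonZero : (X : FinSet) → FinSet.Carrier X → NonZero ∣ X ∣
∣∣-nonZero X x with FinSet.elements X | FinSet.enumerates X x
... | _ ∷ _ | _ = _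

module _ (X : FinSet) where
  open FinSet X

  ∃? : {P : Pred Carrier 0ℓ} → P Respects _≈_ → Unary.Decidable P → Dec (∃ P)
  ∃? resp P? = map′ Any.satisfied
    (λ (x , px) → Any.map (λ x≈y → resp x≈y px) (enumerates x))
    (Any.any? P? elements)

  ∀? : {P : Pred Carrier 0ℓ} → P Respects _≈_ → Unary.Decidable P → Dec (∀ x → P x)
  ∀? {P} resp P? = map′
    (λ ps x → lookup-resp ps (enumerates x))
    (λ p → All.tabulate (λ {x} _ → p x))
    (All.all? P? elements)
    where
    lookup-resp : ∀ {x xs} → All P xs → Any (x ≈_) xs → P x
    lookup-resp (py ∷ _)  (here x≈y)   = resp (≈-sym x≈y) py
    lookup-resp (_ ∷ pys) (there x∈ys) = lookup-resp pys x∈ys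

  subset : (P : Pred Carrier 0ℓ) → P Respects _≈_ → Unary.Decidable P → FinSet
  subset P resp P? = record
    { decSetoid = record
      { Carrier = Σ Carrier P
      ; _≈_ = _≈_ on proj₁
      ; isDecEquivalence = On.isDecEquivalence proj₁ isDecEquivalence
      }
    ; elements   = select elements
    ; enumerates = λ (x , px) → select⁺ px (enumerates x)
    }
    where
    select : List Carrier → List (Σ Carrier P)
    select [] = []
    select (x ∷ xs) with P? x
    ... | yes px = (x , px) ∷ select xs
    ... | no  _  = select xs

    select⁺ : ∀ {x xs} → P x → Any (x ≈_) xs → Any ((x ≈_) ∘ proj₁) (select xs)
    select⁺ {xs = y ∷ ys} px x∈ys with P? y | x∈ys
    ... | yes _  | here x≈y    = here x≈y
    ... | yes _  | there x∈ys′ = there (select⁺ px x∈ys′)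
    ... | no ¬py | here x≈y    = contradiction (resp x≈y px) ¬py
    ... | no _   | there x∈ys′ = select⁺ px x∈ys′

  quotient : (_∼_ : Rel Carrier 0ℓ) → IsEquivalence _∼_ → Decidable _∼_ → _≈_ ⇒ _∼_ → FinSet
  quotient _∼_ isEq _∼?_ ≈⇒∼ = record
    { decSetoid = record
      { _≈_ = _∼_
      ; isDecEquivalence = record { isEquivalence = isEq ; _≟_ = _∼?_ }
      }
    ; elements   = elements
    ; enumerates = λ x → Any.map ≈⇒∼ (enumerates x)
    }

  image : (Y : DecSetoid 0ℓ 0ℓ) (f : Carrier → DecSetoid.Carrier Y) →
          (∀ {x y} → x ≈ y → DecSetoid._≈_ Y (f x) (f y)) → FinSet
  image Y f f-cong = record
    { decSetoid = record
      { Carrier = ∃ λ y → ∃ λ x → f x Y.≈ y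
      ; _≈_ = Y._≈_ on proj₁
      ; isDecEquivalence = On.isDecEquivalence proj₁ (DecSetoid.isDecEquivalence Y)
      }
    ; elements   = map (λ x → f x , x , Y.refl) elements
    ; enumerates = λ (y , x , fx≈y) → Any.map⁺
        (Any.map (λ x≈z → Y.trans (Y.sym fx≈y) (f-cong x≈z)) (enumerates x))
    }
    where module Y = DecSetoid Y

------------------------------------------------------------------------
-- Finite simple graphs and their components

record Graph : Set₁ where
  infix 4 _—_
  field
    vertices : FinSet
  open FinSet vertices public
  field
    _—_      : Rel Carrier 0ℓ
    _—?_     : Decidable _—_
    —-resp-≈ : _—_ Respects₂ _≈_
    —-sym    : Symmetric _—_
    —-irrefl : ∀ {x y} → x ≈ y → ¬ (x — y)

  -- One step of a walk; x ≈ y means that x and y are the same vertex.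
  Step : Rel Carrier 0ℓ
  Step x y = x ≈ y ⊎ x — y

  Connected : Rel Carrier 0ℓ
  Connected = Star Step

  Connected-isEquivalence : IsEquivalence Connected
  Connected-isEquivalence = record
    { refl  = ε
    ; sym   = reverse (Sum.map ≈-sym —-sym)
    ; trans = _◅◅_
    }

  private
    -- Walks all of whose intermediate vertices lie in a given list
    -- (Warshall's algorithm).
    Via : List Carrier → Rel Carrier 0ℓ
    Via []       x y = Step x y
    Via (v ∷ vs) x y = Via vs x y ⊎ Via vs x v × Via vs v y

    via? : ∀ vs → Decidable (Via vs)
    via? []       x y = (x ≟ y) ⊎-dec (x —? y)
    via? (v ∷ vs) x y = via? vs x y ⊎-dec (via? vs x v ×-dec via? vs v y)

    respʳ : ∀ vs {x} → Via vs x Respects _≈_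
    respʳ []       y≈z (inj₁ x≈y)     = inj₁ (≈-trans x≈y y≈z)
    respʳ []       y≈z (inj₂ x—y)     = inj₂ (proj₁ —-resp-≈ y≈z x—y)
    respʳ (v ∷ vs) y≈z (inj₁ p)       = inj₁ (respʳ vs y≈z p)
    respʳ (v ∷ vs) y≈z (inj₂ (p , q)) = inj₂ (p , respʳ vs y≈z q)

    respˡ : ∀ vs {y} → (λ x → Via vs x y) Respects _≈_
    respˡ []       x≈z (inj₁ x≈y)     = inj₁ (≈-trans (≈-sym x≈z) x≈y)
    respˡ []       x≈z (inj₂ x—y)     = inj₂ (proj₂ —-resp-≈ x≈z x—y)
    respˡ (v ∷ vs) x≈z (inj₁ p)       = inj₁ (respˡ vs x≈z p)
    respˡ (v ∷ vs) x≈z (inj₂ (p , q)) = inj₂ (respˡ vs x≈z p , q)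

    to : ∀ vs {x v} → Via (v ∷ vs) x v → Via vs x v
    to vs (inj₁ p)       = p
    to vs (inj₂ (p , _)) = p

    from : ∀ vs {v y} → Via (v ∷ vs) v y → Via vs v y
    from vs (inj₁ p)       = p
    from vs (inj₂ (_ , q)) = q

    join : ∀ vs {x y z} → Any (y ≈_) vs → Via vs x y → Via vs y z → Via vs x z
    join (v ∷ vs) (here y≈v) p q = inj₂
      ( to   vs (respʳ (v ∷ vs) y≈v p)
      , from vs (respˡ (v ∷ vs) y≈v q) )
    join (v ∷ vs) (there y∈) (inj₁ p)        (inj₁ q)        = inj₁ (join vs y∈ p q)
    join (v ∷ vs) (there y∈) (inj₁ p)        (inj₂ (q , q′)) = inj₂ (join vs y∈ p q , q′)
    join (v ∷ vs) (there y∈) (inj₂ (p , p′)) (inj₁ q)        = inj₂ (p , join vs y∈ p′ q)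
    join (v ∷ vs) (there y∈) (inj₂ (p , _))  (inj₂ (_ , q′)) = inj₂ (p , q′)

    sound : ∀ vs {x y} → Via vs x y → Connected x y
    sound []       s              = s ◅ ε
    sound (v ∷ vs) (inj₁ p)       = sound vs p
    sound (v ∷ vs) (inj₂ (p , q)) = sound vs p ◅◅ sound vs q

    step : ∀ vs {x y} → Step x y → Via vs x y
    step []       s = s
    step (v ∷ vs) s = inj₁ (step vs s)

    complete : ∀ {x y} → Connected x y → Via elements x y
    complete ε                 = step elements (inj₁ ≈-refl)
    complete (_◅_ {j = y} s p) = join elements (enumerates y) (step elements s) (complete p)

  connected? : Decidable Connected
  connected? x y = map′ (sound elements) complete (via? elements x y)

  components : FinSet
  components = quotient vertices Connected Connected-isEquivalence connected? (λ x≈y → inj₁ x≈y ◅ ε)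

module _ (X : FinSet) where
  open FinSet X

  -- x and y are adjacent iff they are distinct and x R y or y R x.
  mkGraph : (R : Rel Carrier 0ℓ) → Decidable R → R Respects₂ _≈_ → Graph
  mkGraph R R? (respʳ , respˡ) = record
    { vertices = X
    ; _—_      = λ x y → ¬ (x ≈ y) × (R x y ⊎ R y x)
    ; _—?_     = λ x y → ¬? (x ≟ y) ×-dec (R? x y ⊎-dec R? y x)
    ; —-resp-≈ =
        (λ y≈z (x≉y , r) → (λ x≈z → x≉y (≈-trans x≈z (≈-sym y≈z))) , Sum.map (respʳ y≈z) (respˡ y≈z) r)
      , (λ x≈z (x≉y , r) → (λ z≈y → x≉y (≈-trans x≈z z≈y)) , Sum.map (respˡ x≈z) (respʳ x≈z) r)
    ; —-sym    = λ (x≉y , r) → (x≉y ∘ ≈-sym) , Sum.swap r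
    ; —-irrefl = λ x≈y (x≉y , _) → x≉y x≈y
    }

------------------------------------------------------------------------
-- Existential search for a periodic predicate

module _ (N : ℕ) .{{_ : NonZero N}} {P : Pred ℕ 0ℓ}
         (P? : Unary.Decidable P) (periodic : ∀ a → P (N + a) → P a) where

  private
    reduce : ∀ q r → P (r + q * N) → P r
    reduce zero    r p = subst P (ℕ.+-identityʳ r) p
    reduce (suc q) r p = reduce q r (periodic _ (subst P eq p))
      where
      eq : r + (N + q * N) ≡ N + (r + q * N)
      eq = trans (sym (ℕ.+-assoc r N _)) (trans (cong (_+ q * N) (ℕ.+-comm r N)) (ℕ.+-assoc N r _))

  periodic-∃? : Dec (∃ P)
  periodic-∃? = map′
    (λ (a , _ , p) → a , p)
    (λ (a , p) → a % N , m%n<n a N , reduce (a / N) (a % N) (subst P (m≡m%n+[m/n]*n a N) p))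
    (ℕ.anyUpTo? P? N)

------------------------------------------------------------------------
-- Powers and cyclic subgroups

module Powers (𝔾 : Group 0ℓ 0ℓ) where
  open Group 𝔾 renaming (refl to ≈-refl; sym to ≈-sym; trans to ≈-trans; ε to 1#) hiding (_-_; _//_; _\\_)
  open Mult monoid using () renaming (_×_ to _·_)

  infixr 8 _^_
  _^_ : Carrier → ℤ → Carrier
  x ^ (+ k)    = k · x
  x ^ -[1+ k ] = (suc k · x) ⁻¹

  ⟨_⟩ : Carrier → Pred Carrier 0ℓ
  ⟨ x ⟩ z = ∃ λ k → z ≈ x ^ k

  -- Here and below a positive exponent is written as a successor.
  _IsPositivePowerOf_ : Rel Carrier 0ℓ
  x IsPositivePowerOf y = ∃ λ m → x ≈ y ^ +[1+ m ]

  ^-congʳ : ∀ k {x y} → x ≈ y → x ^ k ≈ y ^ k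
  ^-congʳ (+ k)    = Mult.×-congʳ monoid k
  ^-congʳ -[1+ k ] = ⁻¹-cong ∘ Mult.×-congʳ monoid (suc k)

  ⟨⟩-resp-≈ : ∀ {x} → ⟨ x ⟩ Respects _≈_
  ⟨⟩-resp-≈ y≈z (k , y≈xᵏ) = k , ≈-trans (≈-sym y≈z) y≈xᵏ

  ⟨⟩-cong : ∀ {x y} → x ≈ y → ⟨ x ⟩ ≐ ⟨ y ⟩
  ⟨⟩-cong x≈y = (λ (k , z≈xᵏ) → k , ≈-trans z≈xᵏ (^-congʳ k x≈y))
              , (λ (k , z≈yᵏ) → k , ≈-trans z≈yᵏ (≈-sym (^-congʳ k x≈y)))

  power-resp-≈ : _IsPositivePowerOf_ Respects₂ _≈_
  power-resp-≈ = (λ y≈z (m , x≈yᵐ) → m , ≈-trans x≈yᵐ (^-congʳ +[1+ m ] y≈z))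
               , (λ x≈z (m , x≈yᵐ) → m , ≈-trans (≈-sym x≈z) x≈yᵐ)

  module Finite (_≟_ : Decidable _≈_) (elements : List Carrier)
                (enumerates : IsEnumeration setoid elements) where

    open import Relation.Binary.Reasoning.Setoid setoid

    period : ∀ x → ∃ λ N → NonZero N × N · x ≈ 1#
    period x
      with i , j , i<j , same ← Fin.pigeonhole ℕ.≤-refl (λ (k : Fin (suc (length elements))) → Any.index (enumerates (Fin.toℕ k · x)))
      = d , ℕ.>-nonZero (ℕ.m<n⇒0<n∸m i<j) , GroupProperties.identityʳ-unique 𝔾 (Fin.toℕ i · x) (d · x) (begin
        (Fin.toℕ i · x) ∙ (d · x)       ≈⟨ Mult.×-homo-+ monoid x (Fin.toℕ i) d ⟨
        (Fin.toℕ i + d) · x             ≡⟨ cong (_· x) (ℕ.m+[n∸m]≡n (ℕ.<⇒≤ i<j)) ⟩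
        Fin.toℕ j · x                   ≈⟨ Any.lookup-index (enumerates (Fin.toℕ j · x)) ⟩
        lookup elements (Any.index (enumerates (Fin.toℕ j · x))) ≡⟨ cong (lookup elements) same ⟨
        lookup elements (Any.index (enumerates (Fin.toℕ i · x))) ≈⟨ Any.lookup-index (enumerates (Fin.toℕ i · x)) ⟨
        Fin.toℕ i · x                   ∎)
      where d = Fin.toℕ j ∸ Fin.toℕ i

    +-period : ∀ {x N} → N · x ≈ 1# → ∀ k → (N + k) · x ≈ k · x
    +-period {x} {N} Nx≈1 k = begin
      (N + k) · x        ≈⟨ Mult.×-homo-+ monoid x N k ⟩
      (N · x) ∙ (k · x)  ≈⟨ ∙-congʳ Nx≈1 ⟩
      1# ∙ (k · x)       ≈⟨ identityˡ _ ⟩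
      k · x              ∎

    -- In a finite group every inverse is a natural power.
    ⟨⟩-natural : ∀ {x z} → ⟨ x ⟩ z → ∃ λ k → z ≈ k · x
    ⟨⟩-natural (+ k , z≈xᵏ) = k , z≈xᵏ
    ⟨⟩-natural {x} {z} (-[1+ k ] , z≈x⁻ᵏ)
      with suc N , _ , Nx≈1 ← period x = N * suc k , (begin
      z                     ≈⟨ z≈x⁻ᵏ ⟩
      (suc k · x) ⁻¹        ≈⟨ GroupProperties.inverseʳ-unique 𝔾 (suc k · x) ((N * suc k) · x) (begin
        (suc k · x) ∙ ((N * suc k) · x) ≈⟨ Mult.×-homo-+ monoid x (suc k) (N * suc k) ⟨
        (suc N * suc k) · x             ≡⟨ cong (_· x) (ℕ.*-comm (suc N) (suc k)) ⟩
        (suc k * suc N) · x             ≈⟨ Mult.×-assocˡ monoid x (suc k) (suc N) ⟨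
        suc k · (suc N · x)             ≈⟨ Mult.×-congʳ monoid (suc k) Nx≈1 ⟩
        suc k · 1#                      ≈⟨ Mult.×-idem monoid (identityˡ 1#) (suc k) ⟩
        1#                              ∎) ⟨
      (N * suc k) · x       ∎)

    _∈⟨_⟩? : ∀ z x → Dec (⟨ x ⟩ z)
    z ∈⟨ x ⟩? with N , N≢0 , Nx≈1 ← period x =
      map′ (λ (k , eq) → + k , eq) ⟨⟩-natural
        (periodic-∃? N {{N≢0}} (λ k → z ≟ (k · x)) (λ k eq → ≈-trans eq (+-period {N = N} Nx≈1 k)))

    isPositivePowerOf? : Decidable _IsPositivePowerOf_
    isPositivePowerOf? z x with N , N≢0 , Nx≈1 ← period x =
      periodic-∃? N {{N≢0}} (λ k → z ≟ (suc k · x))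
        (λ k eq → ≈-trans eq (∙-congˡ (+-period {N = N} Nx≈1 k)))

------------------------------------------------------------------------
-- The symmetric group

module _ (n : ℕ) where

  -- Products are read from left to right: i ⟨$⟩ (π ∙ ρ) = (i ⟨$⟩ π) ⟨$⟩ ρ.
  Sym : Group 0ℓ 0ℓ
  Sym = record
    { Carrier = Permutation′ n
    ; _≈_ = Perm._≈_
    ; _∙_ = Perm._∘ₚ_
    ; ε   = Perm.id
    ; _⁻¹ = Perm.flip
    ; isGroup = record
      { isMonoid = record
        { isSemigroup = record
          { isMagma = record
            { isEquivalence = record
              { refl  = λ _ → refl
              ; sym   = λ p i → sym (p i)
              ; trans = λ p q i → trans (p i) (q i)
              }
            ; ∙-cong = λ {_} {_} {_} {σ} p q i → trans (q _) (cong (σ ⟨$⟩ʳ_) (p i))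
            }
          ; assoc = λ _ _ _ _ → refl
          }
        ; identity = (λ _ _ → refl) , (λ _ _ → refl)
        }
      ; inverse = (λ π _ → Perm.inverseʳ π) , (λ π _ → Perm.inverseˡ π)
      ; ⁻¹-cong = λ {π} {ρ} p i → trans (sym (Perm.inverseˡ ρ))
          (cong (ρ Perm.⟨$⟩ˡ_) (trans (sym (p _)) (Perm.inverseʳ π)))
      }
    }

permutations : ∀ n → List (Permutation′ n)
permutations zero    = Perm.id ∷ []
permutations (suc n) = cartesianProductWith (Perm.insert Fin.zero) (allFin (suc n)) (permutations n)

permutations-enumerates : ∀ n → IsEnumeration (Group.setoid (Sym n)) (permutations n)
permutations-enumerates zero    π = here λ ()
permutations-enumerates (suc n) π = Any.cartesianProductWith⁺ (Perm.insert Fin.zero)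
  (λ {i} {ρ} → pres i ρ)
  (∈-allFin (π ⟨$⟩ʳ Fin.zero))
  (permutations-enumerates n (Perm.remove Fin.zero π))
  where
  pres : ∀ i ρ → π ⟨$⟩ʳ Fin.zero ≡ i → Perm.remove Fin.zero π Perm.≈ ρ → π Perm.≈ Perm.insert Fin.zero i ρ
  pres i ρ refl rem≈ρ Fin.zero    = refl
  pres i ρ refl rem≈ρ (Fin.suc k) = trans (sym (Perm.insert-remove Fin.zero π (Fin.suc k)))
    (cong (Fin.punchIn (π ⟨$⟩ʳ Fin.zero)) (rem≈ρ k))

𝕊 : ℕ → FinSet
𝕊 n = record
  { decSetoid = record
    { isDecEquivalence = record
      { isEquivalence = Group.isEquivalence (Sym n)
      ; _≟_ = λ π ρ → Fin.all? (λ i → (π ⟨$⟩ʳ i) Fin.≟ (ρ ⟨$⟩ʳ i))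
      }
    }
  ; elements   = permutations n
  ; enumerates = permutations-enumerates n
  }

module _ {n : ℕ} where
  open Powers (Sym n) public
  open Powers.Finite (Sym n) (FinSet._≟_ (𝕊 n)) (permutations n) (permutations-enumerates n) public

  ⟨⟩≐? : Decidable (_≐_ on ⟨_⟩)
  ⟨⟩≐? x y = map′ (λ (p , q) → (λ {z} → p z) , (λ {z} → q z)) (λ (p , q) → (λ z → p {z}) , (λ z → q {z}))
    (⊆? x y ×-dec ⊆? y x)
    where
    ⊆? : ∀ x y → Dec (∀ z → ⟨ x ⟩ z → ⟨ y ⟩ z)
    ⊆? x y = ∀? (𝕊 n)
      (λ {z} {w} z≈w f → ⟨⟩-resp-≈ {y} {z} {w} z≈w ∘ f ∘ ⟨⟩-resp-≈ {x} {w} {z} (λ i → sym (z≈w i)))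
      (λ z → (z ∈⟨ x ⟩?) →-dec (z ∈⟨ y ⟩?))

  ⟨⟩≐-isEquivalence : IsEquivalence (_≐_ on ⟨_⟩)
  ⟨⟩≐-isEquivalence = record
    { refl  = (λ p → p) , (λ p → p)
    ; sym   = λ (p , q) → (λ {z} → q {z}) , (λ {z} → p {z})
    ; trans = λ (p , q) (p′ , q′) → (λ {z} → p′ {z} ∘ p {z}) , (λ {z} → q {z} ∘ q′ {z})
    }

------------------------------------------------------------------------
-- Partitions, as finite multisets of parts: lists up to _↭_

_↭?_ : Decidable {A = List ℕ} _↭_
[]       ↭? []       = yes ↭-refl
[]       ↭? (y ∷ ys) = no (↭.¬x∷xs↭[] ∘ ↭-sym)
(x ∷ xs) ↭? ys with DecMembership._∈?_ ℕ._≟_ x ys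
... | no  x∉ys = no (λ p → x∉ys (↭.∈-resp-↭ p (here refl)))
... | yes x∈ys with as , bs , refl ← ∈-∃++ x∈ys =
  map′ (λ p → ↭-trans (↭-prep x p) (↭-sym (↭.shift x as bs)))
       (λ p → ↭.drop-∷ (↭-trans p (↭.shift x as bs)))
       (xs ↭? (as ++ bs))

partitions : DecSetoid 0ℓ 0ℓ
partitions = record
  { Carrier = List ℕ
  ; isDecEquivalence = record { isEquivalence = ↭-isEquivalence ; _≟_ = _↭?_ }
  }

order : List ℕ → ℕ
order = foldr lcm 1

gcd-nonZero : ∀ a m .{{_ : NonZero a}} → NonZero (gcd a m)
gcd-nonZero a m = ℕ.≢-nonZero (gcd[m,n]≢0 a m (inj₁ (ℕ.≢-nonZero⁻¹ a)))

-- A cycle of length m splits into gcd(a,m) cycles of length m / gcd(a,m).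
powerOfPart : (a : ℕ) .{{_ : NonZero a}} → ℕ → List ℕ
powerOfPart a m = replicate (gcd a m) (_/_ m (gcd a m) {{gcd-nonZero a m}})

_^ᵀ_ : List ℕ → (a : ℕ) .{{_ : NonZero a}} → List ℕ
T ^ᵀ a = concatMap (powerOfPart a) T

_IsTypePowerOf_ : Rel (List ℕ) 0ℓ
T IsTypePowerOf U = ∃ λ a → T ↭ U ^ᵀ suc a

concatMap-↭ : ∀ (f : ℕ → List ℕ) {xs ys} → xs ↭ ys → concatMap f xs ↭ concatMap f ys
concatMap-↭ f ↭.refl         = ↭-refl
concatMap-↭ f (↭.prep x p)   = ↭.++⁺ˡ (f x) (concatMap-↭ f p)
concatMap-↭ f (↭.swap x y p) = ↭-trans (↭.shifts (f x) (f y)) (↭.++⁺ˡ (f y) (↭.++⁺ˡ (f x) (concatMap-↭ f p)))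
concatMap-↭ f (↭.trans p q)  = ↭-trans (concatMap-↭ f p) (concatMap-↭ f q)

typePower-resp-↭ : _IsTypePowerOf_ Respects₂ _↭_
typePower-resp-↭ = (λ U↭V (a , p) → a , ↭-trans p (concatMap-↭ (powerOfPart (suc a)) U↭V))
                 , (λ T↭V (a , p) → a , ↭-trans (↭-sym T↭V) p)

order-∣ : ∀ {m} T → m ∈ T → m ∣ order T
order-∣ (m ∷ T) (here refl) = m∣lcm[m,n] m (order T)
order-∣ (k ∷ T) (there m∈T) = ∣-trans (order-∣ T m∈T) (n∣lcm[m,n] k (order T))

lcm-nonZero : ∀ m n → NonZero m → NonZero n → NonZero (lcm m n)
lcm-nonZero m n m≢0 n≢0 = ℕ.≢-nonZero λ eq →
  ℕ.≢-nonZero⁻¹ (m * n) {{ℕ.m*n≢0 m n {{m≢0}} {{n≢0}}}}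
    (0∣⇒≡0 (subst (_∣ m * n) eq (lcm-least {m} {n} (m∣m*n n) (n∣m*n m))))

order-nonZero : ∀ {T} → All NonZero T → NonZero (order T)
order-nonZero []       = _
order-nonZero {m ∷ T} (m≢0 ∷ T≢0) = lcm-nonZero m (order T) m≢0 (order-nonZero T≢0)

gcd-periodic : ∀ {N m} a → m ∣ N → gcd (suc (N + a)) m ≡ gcd (suc a) m
gcd-periodic {N} {m} a m∣N = ∣-antisym
  (gcd-greatest (∣m+n∣m⇒∣n (subst (gcd (suc (N + a)) m ∣_) (sym (ℕ.+-suc N a)) (gcd[m,n]∣m (suc (N + a)) m))
                           (∣-trans (gcd[m,n]∣n (suc (N + a)) m) m∣N))
                (gcd[m,n]∣n (suc (N + a)) m))
  (gcd-greatest (subst (gcd (suc a) m ∣_) (ℕ.+-suc N a)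
                  (∣m∣n⇒∣m+n (∣-trans (gcd[m,n]∣n (suc a) m) m∣N) (gcd[m,n]∣m (suc a) m)))
                (gcd[m,n]∣n (suc a) m))

^ᵀ-periodic : ∀ {N} a T → (∀ {m} → m ∈ T → m ∣ N) → T ^ᵀ suc (N + a) ≡ T ^ᵀ suc a
^ᵀ-periodic     a []      _  = refl
^ᵀ-periodic {N} a (m ∷ T) ∣N = cong₂ _++_
  (cong₂ replicate eq (/-congʳ {{gcd-nonZero (suc (N + a)) m}} {{gcd-nonZero (suc a) m}} eq))
  (^ᵀ-periodic a T (∣N ∘ there))
  where eq = gcd-periodic a (∣N (here refl))

isTypePowerOf? : ∀ T U → All NonZero U → Dec (T IsTypePowerOf U)
isTypePowerOf? T U U≢0 = periodic-∃? (order U) {{order-nonZero U≢0}}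
  (λ a → T ↭? (U ^ᵀ suc a))
  (λ a → subst (T ↭_) (^ᵀ-periodic a U (order-∣ U)))

------------------------------------------------------------------------
-- The type of a permutation

module _ {n : ℕ} where

  SameOrbit : Permutation′ n → Rel (Fin n) 0ℓ
  SameOrbit ψ i j = ∃ λ π → ⟨ ψ ⟩ π × π ⟨$⟩ʳ i ≡ j

  sameOrbit? : ∀ ψ → Decidable (SameOrbit ψ)
  sameOrbit? ψ i j = ∃? (𝕊 n)
    (λ {π} {ρ} π≈ρ (p , eq) → ⟨⟩-resp-≈ {x = ψ} {π} {ρ} π≈ρ p , trans (sym (π≈ρ i)) eq)
    (λ π → (π ∈⟨ ψ ⟩?) ×-dec ((π ⟨$⟩ʳ i) Fin.≟ j))

  orbitLength : Permutation′ n → Fin n → ℕ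
  orbitLength ψ i = length (filter (sameOrbit? ψ i) (allFin n))

  -- deduplicate keeps exactly one point of every orbit.
  type : Permutation′ n → List ℕ
  type ψ = map (orbitLength ψ) (deduplicate (sameOrbit? ψ) (allFin n))

  type-cong : ∀ {ψ χ} → ⟨ ψ ⟩ ≐ ⟨ χ ⟩ → type ψ ≡ type χ
  type-cong {ψ} {χ} (ψ⊆χ , χ⊆ψ) = trans
    (map-cong (λ i → cong length (filter-≐ (sameOrbit? ψ i) (sameOrbit? χ i) (to , from) (allFin n))) (deduplicate (sameOrbit? ψ) (allFin n)))
    (cong (map (orbitLength χ)) (dedup (allFin n)))
    where
    to : SameOrbit ψ ⇒ SameOrbit χ
    to (π , p , eq) = π , ψ⊆χ {π} p , eq

    from : SameOrbit χ ⇒ SameOrbit ψ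
    from (π , p , eq) = π , χ⊆ψ {π} p , eq

    dedup : ∀ xs → deduplicate (sameOrbit? ψ) xs ≡ deduplicate (sameOrbit? χ) xs
    dedup []       = refl
    dedup (x ∷ xs) = cong (x ∷_) (trans
      (filter-≐ (¬? ∘ sameOrbit? ψ x) (¬? ∘ sameOrbit? χ x) ((_∘ from) , (_∘ to)) (deduplicate (sameOrbit? ψ) xs))
      (cong (filter (¬? ∘ sameOrbit? χ x)) (dedup xs)))

  type-cong-≈ : ∀ {ψ χ} → ψ Perm.≈ χ → type ψ ≡ type χ
  type-cong-≈ {ψ} {χ} ψ≈χ = type-cong (⟨⟩-cong {x = ψ} {χ} ψ≈χ)

  type-nonZero : ∀ ψ → All NonZero (type ψ)
  type-nonZero ψ = All.map⁺ (All.tabulate λ {i} _ → nonEmpty (∈-filter⁺ (sameOrbit? ψ i) (∈-allFin i)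
    (Perm.id , (+ 0 , λ _ → refl) , refl)))
    where
    nonEmpty : ∀ {i : Fin n} {xs} → i ∈ xs → NonZero (length xs)
    nonEmpty (here _)  = _
    nonEmpty (there _) = _

------------------------------------------------------------------------
-- Permutation groups

-- Membership is decidable, as for any subset of a finite set classically.
record Subgroup (n : ℕ) : Set₁ where
  open Group (Sym n) using (_≈_; _∙_; _⁻¹) renaming (ε to 1#)
  field
    member    : Pred (Permutation′ n) 0ℓ
    member?   : Unary.Decidable member
    resp-≈    : member Respects _≈_
    1-closed  : member 1#
    ∙-closed  : ∀ {π ρ} → member π → member ρ → member (π ∙ ρ)
    ⁻¹-closed : ∀ {π} → member π → member (π ⁻¹)

module _ {n : ℕ} (G : Subgroup n) where
  open Group (Sym n) using (_≈_; _∙_; _⁻¹) renaming (ε to 1#)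
  open Subgroup G

  Normalizes : Pred (Permutation′ n) 0ℓ
  Normalizes y = ∀ g → member g ⇔ member (y ⁻¹ ∙ g ∙ y)

  FusionControlled : Set
  FusionControlled = ∀ ψ x → member ψ → member (x ⁻¹ ∙ ψ ∙ x) →
    ∃ λ y → Normalizes y × x ⁻¹ ∙ ψ ∙ x ≈ y ⁻¹ ∙ ψ ∙ y

  elementsOf : FinSet
  elementsOf = subset (𝕊 n) member resp-≈ member?

  nonIdentity : FinSet
  nonIdentity = subset elementsOf (λ (x , _) → ¬ x ≈ 1#)
    (λ {(x , _)} {(y , _)} x≈y x≉1 y≈1 → x≉1 (λ i → trans (x≈y i) (y≈1 i)))
    (λ (x , _) → ¬? (FinSet._≟_ (𝕊 n) x 1#))

  G₀ : Set
  G₀ = FinSet.Carrier nonIdentity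

  ⌊_⌋ : G₀ → Permutation′ n
  ⌊ (x , _) , _ ⌋ = x

  properPowerGraph : Graph
  properPowerGraph = mkGraph nonIdentity (_IsPositivePowerOf_ on ⌊_⌋)
    (λ x y → isPositivePowerOf? ⌊ x ⌋ ⌊ y ⌋)
    ( (λ {x} {y} {z} → proj₁ power-resp-≈ {⌊ x ⌋} {⌊ y ⌋} {⌊ z ⌋})
    , (λ {y} {x} {z} → proj₂ power-resp-≈ {⌊ y ⌋} {⌊ x ⌋} {⌊ z ⌋}))

  c₀ : ℕ
  c₀ = ∣ Graph.components properPowerGraph ∣

  -- x ≋ y iff [ x ] = [ y ].
  _≋_ : Rel G₀ 0ℓ
  x ≋ y = ⟨ ⌊ x ⌋ ⟩ ≐ ⟨ ⌊ y ⌋ ⟩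

  ≋-isEquivalence : IsEquivalence _≋_
  ≋-isEquivalence = On.isEquivalence ⌊_⌋ ⟨⟩≐-isEquivalence

  _≋?_ : Decidable _≋_
  x ≋? y = ⟨⟩≐? ⌊ x ⌋ ⌊ y ⌋

  cyclicClasses : FinSet
  cyclicClasses = quotient nonIdentity _≋_ ≋-isEquivalence _≋?_
    (λ {x} {y} → ⟨⟩-cong {x = ⌊ x ⌋} {⌊ y ⌋})

  -- [ x ] contains a positive power of some element of [ y ].
  _IsClassPowerOf_ : Rel G₀ 0ℓ
  x IsClassPowerOf y = ∃₂ λ x′ y′ → x′ ≋ x × y′ ≋ y × ⌊ x′ ⌋ IsPositivePowerOf ⌊ y′ ⌋

  classPower-resp-≋ : _IsClassPowerOf_ Respects₂ _≋_
  classPower-resp-≋ =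
      (λ {x} {y} {z} y≋z (x′ , y′ , p , q , r) → x′ , y′ , p , ≋.trans {y′} {y} {z} q y≋z , r)
    , (λ {y} {x} {z} x≋z (x′ , y′ , p , q , r) → x′ , y′ , ≋.trans {x′} {x} {z} p x≋z , q , r)
    where module ≋ = IsEquivalence ≋-isEquivalence

  isClassPowerOf? : Decidable _IsClassPowerOf_
  isClassPowerOf? x y =
    ∃? nonIdentity
      (λ {a} {b} a≈b (y′ , p , q , r) → y′ , transport {a} {b} {x} a≈b p , q
         , proj₂ power-resp-≈ {⌊ y′ ⌋} {⌊ a ⌋} {⌊ b ⌋} a≈b r)
      (λ x′ → ∃? nonIdentity
        (λ {a} {b} a≈b (p , q , r) → p , transport {a} {b} {y} a≈b q
           , proj₁ power-resp-≈ {⌊ x′ ⌋} {⌊ a ⌋} {⌊ b ⌋} a≈b r)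
        (λ y′ → (x′ ≋? x) ×-dec ((y′ ≋? y) ×-dec isPositivePowerOf? ⌊ x′ ⌋ ⌊ y′ ⌋)))
    where
    module ≋ = IsEquivalence ≋-isEquivalence

    transport : ∀ {a b c : G₀} → ⌊ a ⌋ ≈ ⌊ b ⌋ → a ≋ c → b ≋ c
    transport {a} {b} {c} a≈b a≋c = ≋.trans {b} {a} {c} (≋.sym {a} {b} (⟨⟩-cong {x = ⌊ a ⌋} {⌊ b ⌋} a≈b)) a≋c

  properQuotientPowerGraph : Graph
  properQuotientPowerGraph = mkGraph cyclicClasses _IsClassPowerOf_ isClassPowerOf?
    ( (λ {x} {y} {z} → proj₁ classPower-resp-≋ {x} {y} {z})
    , (λ {y} {x} {z} → proj₂ classPower-resp-≋ {y} {x} {z}))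

  -- The set 𝒯(G₀); an element is a partition that is the type of some x in G₀.
  types : FinSet
  types = image nonIdentity partitions (type ∘ ⌊_⌋)
    (λ {x} {y} x≈y → ↭-reflexive (type-cong-≈ {ψ = ⌊ x ⌋} {⌊ y ⌋} x≈y))

  𝒯₀ : Set
  𝒯₀ = FinSet.Carrier types

  types-nonZero : (T : 𝒯₀) → All NonZero (proj₁ T)
  types-nonZero (_ , ψ , type≡T) = ↭.All-resp-↭ type≡T (type-nonZero ⌊ ψ ⌋)

  properPowerTypeGraph : Graph
  properPowerTypeGraph = mkGraph types (_IsTypePowerOf_ on proj₁)
    (λ T U → isTypePowerOf? (proj₁ T) (proj₁ U) (types-nonZero U))
    ( (λ {T} {U} {V} → proj₁ typePower-resp-↭ {proj₁ T} {proj₁ U} {proj₁ V})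
    , (λ {U} {T} {V} → proj₂ typePower-resp-↭ {proj₁ U} {proj₁ T} {proj₁ V}))

  c₀𝒯 : ℕ
  c₀𝒯 = ∣ Graph.components properPowerTypeGraph ∣

  μ : List ℕ → ℕ
  μ T = ∣ subset elementsOf (λ (x , _) → type x ↭ T)
    (λ {(x , _)} {(y , _)} x≈y p → ↭-trans (↭-reflexive (sym (type-cong-≈ {ψ = x} {y} x≈y))) p)
    (λ (x , _) → type x ↭? T) ∣

  -- A component of the quotient power graph, given by any of its vertices.
  Component : Set
  Component = FinSet.Carrier (Graph.components properQuotientPowerGraph)

  _HasVertex_ : Component → G₀ → Set
  C HasVertex x = Graph.Connected properQuotientPowerGraph C x

  verticesOfType : Component → List ℕ → FinSet
  verticesOfType C T = subset cyclicClasses (λ x → C HasVertex x × type ⌊ x ⌋ ↭ T)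
    (λ {x} {y} x≋y (p , q) → (p ◅◅ inj₁ x≋y ◅ ε)
      , ↭-trans (↭-reflexive (sym (type-cong {ψ = ⌊ x ⌋} {⌊ y ⌋} x≋y))) q)
    (λ x → Graph.connected? properQuotientPowerGraph C x ×-dec (type ⌊ x ⌋ ↭? T))

  ContainsType : Component → List ℕ → Set
  ContainsType C T = ∃ λ x → C HasVertex x × type ⌊ x ⌋ ↭ T

  k : Component → List ℕ → ℕ
  k C T = ∣ verticesOfType C T ∣

------------------------------------------------------------------------
-- Euler's totient

-- Counts 1 ≤ a ≤ m coprime to m, so that φ 1 = 1.
φ : ℕ → ℕ
φ m = length (filter (λ a → coprime? a m) (map suc (upTo m)))

φ-nonZero : ∀ m .{{_ : NonZero m}} → NonZero (φ m)
φ-nonZero (suc m) with filter (λ a → coprime? a (suc m)) (map suc (upTo (suc m)))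
  | ∈-filter⁺ (λ a → coprime? a (suc m)) (∈-map⁺ suc (∈-upTo⁺ {suc m} {0} ℕ.z<s)) (1-coprimeTo (suc m))
... | _ ∷ _ | _ = _

denominator-nonZero : ∀ {n} (G : Subgroup n) (T : 𝒯₀ G) (C : Component G) →
  ContainsType G C (proj₁ T) →
  NonZero (φ (order (proj₁ T)) * k G C (proj₁ T))
denominator-nonZero G T C v = ℕ.m*n≢0 (φ (order (proj₁ T))) (k G C (proj₁ T))
  {{φ-nonZero (order (proj₁ T)) {{order-nonZero (types-nonZero G T)}}}}
  {{∣∣-nonZero (verticesOfType G C (proj₁ T)) v}}

-- The components of the power graph and of its quotient are the same partition of G₀,
-- and x ↦ T_x maps each of them into a component of the type graph.  A step from T_x in
-- the type graph lifts to a step from x: downwards because powers of x lie in G, upwards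
-- because S_n-conjugate elements of G are conjugate under N(G) (fusion control), so that
-- a root of a conjugate of x can be moved to a root of x.  Hence every component over
-- C(T_i) contains classes of type T_i; as N(G) acts on the graph and is transitive on
-- these classes, each contains the same number k of them.  There are μ/φ(o(T_i)) classes
-- of type T_i, so μ/(φ k) components over C(T_i).
--
-- The facts on types are obtained from fixed points: ψᵈ has Σ {m | m a part of T_ψ, m ∣ d}
-- of them, these numbers determine T_ψ, and they are evidently compatible with powers and
-- conjugation.

module Submission where

open import Defs
import Data.Rational.Properties
open import Algebra.Properties.CommutativeMonoid.Sum Data.Rational.Properties.+-0-commutativeMonoid using (sum; sum-cong-≗)
open import Data.Fin using (Fin)
open import Data.Integer using (+_)
open import Data.Nat using (ℕ; _≤_; _*_)
open import Data.Product using (∃; proj₁)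
open import Data.Rational using (_/_)
open import Relation.Binary.PropositionalEquality using (_≡_)

open import Level using (0ℓ)
open import Algebra.Bundles using (Group)
import Algebra.Properties.Monoid.Mult as Mult
import Algebra.Properties.Monoid.Sum
open import Data.Bool using (if_then_else_)
open import Data.Fin as Fin using (zero; suc; _↑ˡ_; _↑ʳ_)
open import Data.Fin.Permutation as Perm using (Permutation; Permutation′; _⟨$⟩ʳ_; _⟨$⟩ˡ_; _∘ₚ_)
import Data.Fin.Properties as Fin
open import Data.Integer as ℤ using (-[1+_])
import Data.Integer.Properties as ℤ
open import Data.List using (List; []; _∷_; _++_; map; filter; deduplicate; length; lookup; replicate; allFin; upTo)
open import Data.List.Membership.Propositional using (_∈_)
open import Data.List.Membership.Propositional.Properties using (∈-lookup; ∈-allFin; ∈-filter⁺; ∈-filter⁻; ∈-map⁺; ∈-map⁻; ∈-upTo⁺; ∈-upTo⁻; ∈-∃++)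
open import Data.List.Properties using (map-++; length-map)
open import Data.List.Relation.Binary.Permutation.Homogeneous using (onIndices)
open import Data.List.Relation.Binary.Permutation.Propositional as ↭ using (_↭_; ↭-refl; ↭-sym; ↭-trans; ↭-prep; ↭-reflexive; ↭⇒↭ₛ)
import Data.List.Relation.Binary.Permutation.Propositional.Properties as ↭
import Data.List.Relation.Binary.Permutation.Setoid.Properties as ↭ₛ
open import Data.List.Relation.Unary.All as All using (All; []; _∷_)
import Data.List.Relation.Unary.All.Properties as All
open import Data.List.Relation.Unary.AllPairs as AllPairs using (AllPairs; []; _∷_)
import Data.List.Relation.Unary.AllPairs.Properties as AllPairs
open import Data.List.Relation.Unary.Any as Any using (Any; here; there)
import Data.List.Relation.Unary.Any.Properties as Any
open import Data.List.Relation.Unary.Unique.Propositional using (Unique)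
import Data.List.Relation.Unary.Unique.Propositional.Properties as Unique
open import Data.Nat as ℕ using (zero; suc; _+_; _∸_; _%_; _<_; NonZero; ∣_-_∣)
open import Data.Nat.Coprimality as Coprimality using (Coprime; coprime?; coprime-Bézout)
open import Data.Nat.Divisibility
open import Data.Nat.DivMod using (m≡m%n+[m/n]*n; m%n<n; m*[n/m]≡n)
open import Data.Nat.GCD using (gcd; gcd[m,n]∣m; gcd[m,n]∣n; n/gcd[m,n]≢0; module Bézout)
open import Data.Nat.Induction using (<-rec)
open import Data.Nat.LCM using (lcm-least)
open import Data.Nat.ListAction using () renaming (sum to ∑)
open import Data.Nat.ListAction.Properties using (sum-++; sum-↭)
import Data.Nat.Properties as ℕ
open import Data.Product using (Σ; _×_; _,_; proj₂)
import Data.Rational as ℚ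
import Data.Rational.Properties as ℚ
import Data.Rational.Unnormalised as ℚᵘ
import Data.Rational.Unnormalised.Properties as ℚᵘ
open import Data.Sum using (_⊎_; inj₁; inj₂)
open import Function using (_∘_; _on_; Equivalence)
open import Relation.Binary using (Rel; Decidable; IsEquivalence)
import Relation.Binary.Construct.On as On
open import Relation.Binary.Construct.Closure.ReflexiveTransitive using (Star; ε; _◅_)
open import Relation.Binary.PropositionalEquality as ≡ using (refl; sym; trans; cong; cong₂; subst)
open import Relation.Nullary using (Dec; does; yes; no; ¬_; ¬?; contradiction)
open import Relation.Unary as Unary using (Pred; _≐_)

module ℕΣ = Algebra.Properties.Monoid.Sum ℕ.+-0-monoid

-- Counting

-- The quotient of A by _≈_ has n elements: index is a bijection from it to Fin n.
record Card {A : Set} (_≈_ : Rel A 0ℓ) (n : ℕ) : Set where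
  field
    index       : A → Fin n
    index-cong  : ∀ {x y} → x ≈ y → index x ≡ index y
    injective   : ∀ {x y} → index x ≡ index y → x ≈ y
    element     : Fin n → A
    index-element : ∀ i → index (element i) ≡ i

open Card

module _ {A B : Set} {_≈_ : Rel A 0ℓ} {_∼_ : Rel B 0ℓ} where

  -- The map on indices sends `i` to the index of `f` at the representative `element X i`; since `f`
  -- reflects equivalence, it is injective, and the pigeonhole principle applies.
  card-≤ : ∀ {m n} → Card _≈_ m → Card _∼_ n →
           (f : A → B) → (∀ {x y} → f x ∼ f y → x ≈ y) → m ≤ n
  card-≤ X Y f f-inj = Fin.injective⇒≤ {f = index Y ∘ f ∘ element X} λ {i} {j} eq →
    trans (sym (index-element X i)) (trans (index-cong X (f-inj (injective Y eq))) (index-element X j))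

  card-map : ∀ {n} → Card _≈_ n → (f : B → A) → (∀ {x y} → x ∼ y → f x ≈ f y) →
             (∀ {x y} → f x ≈ f y → x ∼ y) → (∀ a → ∃ λ b → f b ≈ a) → Card _∼_ n
  card-map X f f-cong f-inj f-surj = record
    { index         = index X ∘ f
    ; index-cong    = index-cong X ∘ f-cong
    ; injective     = f-inj ∘ injective X
    ; element       = proj₁ ∘ f-surj ∘ element X
    ; index-element = λ i → trans (index-cong X (proj₂ (f-surj (element X i)))) (index-element X i)
    }

card-unique : ∀ {A : Set} {_≈_ : Rel A 0ℓ} {m n} → Card _≈_ m → Card _≈_ n → m ≡ n
card-unique X Y = ℕ.≤-antisym (card-≤ X Y (λ x → x) (λ p → p)) (card-≤ Y X (λ x → x) (λ p → p))

card-empty : ∀ {A : Set} {_≈_ : Rel A 0ℓ} → ¬ A → Card _≈_ 0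
card-empty ¬A = record
  { index = λ x → contradiction x ¬A ; index-cong = λ {x} _ → contradiction x ¬A
  ; injective = λ {x} _ → contradiction x ¬A ; element = λ () ; index-element = λ () }

-- Places the sets `Fin (n i)` one after the other as blocks of `Fin (ℕΣ.sum n)`.
inject-Σ : ∀ {m} (n : Fin m → ℕ) i → Fin (n i) → Fin (ℕΣ.sum n)
inject-Σ n zero    j = j ↑ˡ _
inject-Σ n (suc i) j = n zero ↑ʳ inject-Σ (n ∘ suc) i j

split-Σ : ∀ {m} (n : Fin m → ℕ) (k : Fin (ℕΣ.sum n)) → ∃ λ i → ∃ λ j → inject-Σ n i j ≡ k
split-Σ {suc m} n k with Fin.splitAt (n zero) k in eq
... | inj₁ j = zero , j , Fin.splitAt⁻¹-↑ˡ eq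
... | inj₂ k′ with i , j , eq′ ← split-Σ (n ∘ suc) k′
  = suc i , j , trans (cong (n zero ↑ʳ_) eq′) (Fin.splitAt⁻¹-↑ʳ eq)

↑ˡ≢↑ʳ : ∀ {m n} {i : Fin m} {j : Fin n} → ¬ i ↑ˡ n ≡ m ↑ʳ j
↑ˡ≢↑ʳ {m} {n} {i} {j} eq
  with () ← trans (sym (Fin.splitAt-↑ˡ m i n)) (trans (cong (Fin.splitAt m) eq) (Fin.splitAt-↑ʳ m n j))

inject-Σ-injective : ∀ {m} (n : Fin m → ℕ) {i i′ j j′} →
  inject-Σ n i j ≡ inject-Σ n i′ j′ → Σ (i ≡ i′) λ p → subst (Fin ∘ n) p j ≡ j′
inject-Σ-injective n {zero}  {zero}   eq = refl , Fin.↑ˡ-injective _ _ _ eq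
inject-Σ-injective n {zero}  {suc i′} eq = contradiction eq ↑ˡ≢↑ʳ
inject-Σ-injective n {suc i} {zero}   eq = contradiction (sym eq) ↑ˡ≢↑ʳ
inject-Σ-injective n {suc i} {suc i′} eq
  with inject-Σ-injective (n ∘ suc) {i} {i′} (Fin.↑ʳ-injective (n zero) _ _ eq)
... | refl , eq′ = refl , eq′

module _ {A : Set} {_≈_ : Rel A 0ℓ} where

  -- The fibre over `i` fills the block `i` of `inject-Σ`.
  card-Σ : ∀ {m} (f : A → Fin m) → (∀ {x y} → x ≈ y → f x ≡ f y) → (n : Fin m → ℕ) →
           (∀ i → Card {Σ A λ x → f x ≡ i} (_≈_ on proj₁) (n i)) → Card _≈_ (ℕΣ.sum n)
  card-Σ f f-cong n X = record
    { index         = idx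
    ; index-cong    = λ {x} {y} x≈y → lemma (f-cong x≈y) x≈y
    ; injective     = λ {x} {y} eq → let p , q = inject-Σ-injective n eq in inj p refl refl q
    ; element       = λ k → let i , j , _ = split-Σ n k in proj₁ (element (X i) j)
    ; index-element = λ k → let i , j , eq = split-Σ n k in
        trans (idx-fibre (element (X i) j)) (trans (cong (inject-Σ n i) (index-element (X i) j)) eq)
    }
    where
    idx : A → Fin (ℕΣ.sum n)
    idx x = inject-Σ n (f x) (index (X (f x)) (x , refl))

    idx-fibre : ∀ {i} ((x , p) : Σ A λ x → f x ≡ i) → idx x ≡ inject-Σ n i (index (X i) (x , p))
    idx-fibre (x , refl) = refl

    lemma : ∀ {x y} → f x ≡ f y → x ≈ y → idx x ≡ idx y
    lemma {x} {y} p x≈y = trans (idx-fibre (x , p)) (cong (inject-Σ n (f y)) (index-cong (X (f y)) x≈y))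

    -- The values of `f` are generalised to variables `i` and `j`, so that `p` can be matched with
    -- `refl` and the `subst` vanishes.
    inj : ∀ {x y i j} (p : i ≡ j) (u : f x ≡ i) (v : f y ≡ j) →
          subst (Fin ∘ n) p (index (X i) (x , u)) ≡ index (X j) (y , v) → x ≈ y
    inj refl u v eq = injective (X _) eq

  -- Double counting with constant fibres: the fibre over an index is the fibre over the chosen
  -- representative of that class.
  card-fibres : ∀ {B : Set} {_∼_ : Rel B 0ℓ} {m k} → Card _∼_ m →
                (f : A → B) → (∀ {x y} → x ≈ y → f x ∼ f y) →
                (∀ b → Card {Σ A λ x → f x ∼ b} (_≈_ on proj₁) k) → Card _≈_ (m * k)
  card-fibres {m = m} {k} Y f f-cong X = subst (Card _≈_) (sum-const m)
    (card-Σ (index Y ∘ f) (index-cong Y ∘ f-cong) (λ _ → k) λ i → card-map (X (element Y i))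
      (λ (x , p) → x , injective Y (trans p (sym (index-element Y i))))
      (λ p → p) (λ p → p)
      (λ xp@(x , p) → (x , trans (index-cong Y p) (index-element Y i)) , injective (X _) {xp} {xp} refl))
    where
    sum-const : ∀ m → ℕΣ.sum {m} (λ _ → k) ≡ m * k
    sum-const zero    = refl
    sum-const (suc m) = cong (λ c → k + c) (sum-const m)

lookup-AllPairs : ∀ {A : Set} {R : Rel A 0ℓ} {xs} → (∀ {x y} → R x y → R y x) → AllPairs R xs →
                  ∀ i j → ¬ i ≡ j → R (lookup xs i) (lookup xs j)
lookup-AllPairs R-sym (px ∷ pxs) zero    zero    i≢j = contradiction refl i≢j
lookup-AllPairs R-sym (px ∷ pxs) zero    (suc j) i≢j = All.lookup px (∈-lookup j)
lookup-AllPairs R-sym (px ∷ pxs) (suc i) zero    i≢j = R-sym (All.lookup px (∈-lookup i))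
lookup-AllPairs R-sym (px ∷ pxs) (suc i) (suc j) i≢j = lookup-AllPairs R-sym pxs i j (i≢j ∘ cong suc)

-- Positions in the list serve as indices. As no entry is repeated, the position does not depend on
-- the membership proof that `from` yields.
card-list : ∀ {A : Set} {P : Pred A 0ℓ} {xs} → Unique xs → (∀ {x} → x ∈ xs → P x) →
            (∀ {x} → P x → x ∈ xs) → Card {Σ A P} (_≡_ on proj₁) (length xs)
card-list {A} {P} {xs} u to from = record
  { index         = λ (x , p) → Any.index (from p)
  ; index-cong    = λ {(x , p)} {(y , q)} eq → lookup-inj _ _
      (trans (sym (Any.lookup-index (from p))) (trans eq (Any.lookup-index (from q))))
  ; injective     = λ {(x , p)} {(y , q)} eq →
      trans (Any.lookup-index (from p)) (trans (cong (lookup xs) eq) (sym (Any.lookup-index (from q))))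
  ; element       = λ i → lookup xs i , to (∈-lookup i)
  ; index-element = λ i → lookup-inj _ _ (sym (Any.lookup-index (from (to (∈-lookup i)))))
  }
  where
  lookup-inj : ∀ i j → lookup xs i ≡ lookup xs j → i ≡ j
  lookup-inj i j eq with i Fin.≟ j
  ... | yes p = p
  ... | no i≢j = contradiction eq (lookup-AllPairs (λ p → p ∘ sym) u i j i≢j)

module _ {A : Set} {_≈_ : Rel A 0ℓ} (isEq : IsEquivalence _≈_) (_≟_ : Decidable _≈_) where
  private module ≈ = IsEquivalence isEq

  -- The deduplicated list is a system of representatives: `any` finds every class in it, and by
  -- `dedup` no class occurs twice.
  card-deduplicate : ∀ {xs} → (∀ x → Any (x ≈_) xs) → Card _≈_ (length (deduplicate _≟_ xs))
  card-deduplicate {xs} enumerates = record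
    { index         = λ x → Any.index (any x)
    ; index-cong    = λ {x} {y} x≈y → lookup-inj _ _
        (≈.trans (≈.sym (Any.lookup-index (any x))) (≈.trans x≈y (Any.lookup-index (any y))))
    ; injective     = λ {x} {y} eq → ≈.trans (Any.lookup-index (any x))
        (≈.trans (≈.reflexive (cong (lookup ys) eq)) (≈.sym (Any.lookup-index (any y))))
    ; element       = lookup ys
    ; index-element = λ i → lookup-inj _ _ (≈.sym (Any.lookup-index (any (lookup ys i))))
    }
    where
    ys = deduplicate _≟_ xs

    any : ∀ x → Any (x ≈_) ys
    any x = Any.deduplicate⁺ _≟_ (λ y≈z x≈y → ≈.trans x≈y (≈.sym y≈z)) (enumerates x)

    dedup : ∀ xs → AllPairs (λ x y → ¬ x ≈ y) (deduplicate _≟_ xs)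
    dedup []       = []
    dedup (x ∷ xs) = All.all-filter (¬? ∘ (x ≟_)) (deduplicate _≟_ xs) ∷ AllPairs.filter⁺ (¬? ∘ (x ≟_)) (dedup xs)

    lookup-inj : ∀ i j → lookup ys i ≈ lookup ys j → i ≡ j
    lookup-inj i j eq with i Fin.≟ j
    ... | yes p = p
    ... | no i≢j = contradiction eq (lookup-AllPairs (λ p → p ∘ ≈.sym) (dedup xs) i j i≢j)

card-∣∣ : (X : FinSet) → Card (FinSet._≈_ X) ∣ X ∣
card-∣∣ X = card-deduplicate isEquivalence _≟_ enumerates
  where open FinSet X

-- Orbits, types and fixed points

module _ {n : ℕ} where
  open Mult (Group.monoid (Sym n)) public using () renaming (_×_ to _·_)

least : {P : Pred ℕ 0ℓ} → Unary.Decidable P → ∀ m → P m → ∃ λ k → P k × (∀ l → l < k → ¬ P l)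
least {P} P? = <-rec _ λ m rec pm → go m rec pm (ℕ.anyUpTo? P? m)
  where
  go : ∀ m → (∀ {l} → l < m → P l → _) → P m → Dec _ → _
  go m rec pm (yes (l , l<m , pl)) = rec l<m pl
  go m rec pm (no ¬p)              = m , pm , λ l l<m pl → ¬p (l , l<m , pl)

-- A nonzero distance between two numbers below `p` is itself below `p`, so `p` cannot divide it.
∣∣-∣-<⇒≡ : ∀ {p r s} → r < p → s < p → p ∣ ∣ r - s ∣ → r ≡ s
∣∣-∣-<⇒≡ {p} {r} {s} r<p s<p p∣ with ∣ r - s ∣ in eq
... | zero  = ℕ.∣m-n∣≡0⇒m≡n eq
... | suc d = contradiction p∣ (>⇒∤ (subst (_< p) eq (ℕ.≤-<-trans (ℕ.∣m-n∣≤m⊔n r s) (ℕ.⊔-lub r<p s<p))))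

module _ {n : ℕ} (ψ : Permutation′ n) where

  ·-+ : ∀ a b i → (a + b) · ψ ⟨$⟩ʳ i ≡ b · ψ ⟨$⟩ʳ (a · ψ ⟨$⟩ʳ i)
  ·-+ zero    b i = refl
  ·-+ (suc a) b i = ·-+ a b (ψ ⟨$⟩ʳ i)

  ·-* : ∀ a b i → a · (b · ψ) ⟨$⟩ʳ i ≡ (a * b) · ψ ⟨$⟩ʳ i
  ·-* zero    b i = refl
  ·-* (suc a) b i = trans (·-* a b _) (sym (·-+ b (a * b) i))

  ·-fixed : ∀ a {i} → ψ ⟨$⟩ʳ i ≡ i → a · ψ ⟨$⟩ʳ i ≡ i
  ·-fixed zero    eq = refl
  ·-fixed (suc a) eq = trans (cong (a · ψ ⟨$⟩ʳ_) eq) (·-fixed a eq)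

⟨$⟩ʳ-injective : ∀ {m n} (ψ : Permutation m n) {i j} → ψ ⟨$⟩ʳ i ≡ ψ ⟨$⟩ʳ j → i ≡ j
⟨$⟩ʳ-injective ψ eq = trans (sym (Perm.inverseˡ ψ)) (trans (cong (ψ ⟨$⟩ˡ_) eq) (Perm.inverseˡ ψ))

module _ {n : ℕ} (ψ : Permutation′ n) where

  ·-∣ : ∀ d {a i} → d · ψ ⟨$⟩ʳ i ≡ i → d ∣ a → a · ψ ⟨$⟩ʳ i ≡ i
  ·-∣ d eq (divides-refl q) = trans (sym (·-* ψ q d _)) (·-fixed (d · ψ) q eq)

  ·-∸ : ∀ {a b} → a ≤ b → ∀ i → b · ψ ⟨$⟩ʳ i ≡ a · ψ ⟨$⟩ʳ ((b ∸ a) · ψ ⟨$⟩ʳ i)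
  ·-∸ {a} {b} a≤b i = trans (cong (λ c → c · ψ ⟨$⟩ʳ i) (sym (ℕ.m∸n+n≡m a≤b))) (·-+ ψ (b ∸ a) a i)

  -- The smaller of the two powers is cancelled, permutations being injective.
  ·-∣-∣ : ∀ a b {i} → a · ψ ⟨$⟩ʳ i ≡ b · ψ ⟨$⟩ʳ i → ∣ a - b ∣ · ψ ⟨$⟩ʳ i ≡ i
  ·-∣-∣ a b {i} eq with ℕ.≤-total a b
  ... | inj₁ a≤b = subst (λ c → c · ψ ⟨$⟩ʳ i ≡ i) (sym (ℕ.m≤n⇒∣m-n∣≡n∸m a≤b))
    (⟨$⟩ʳ-injective (a · ψ) (trans (sym (·-∸ a≤b i)) (sym eq)))
  ... | inj₂ b≤a = subst (λ c → c · ψ ⟨$⟩ʳ i ≡ i) (sym (ℕ.m≤n⇒∣n-m∣≡n∸m b≤a))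
    (⟨$⟩ʳ-injective (b · ψ) (trans (sym (·-∸ b≤a i)) eq))

  ·-∣-∣⁻ : ∀ a b {i} → ∣ a - b ∣ · ψ ⟨$⟩ʳ i ≡ i → a · ψ ⟨$⟩ʳ i ≡ b · ψ ⟨$⟩ʳ i
  ·-∣-∣⁻ a b {i} eq with ℕ.≤-total a b
  ... | inj₁ a≤b = sym (trans (·-∸ a≤b i) (cong (a · ψ ⟨$⟩ʳ_)
    (subst (λ c → c · ψ ⟨$⟩ʳ i ≡ i) (ℕ.m≤n⇒∣m-n∣≡n∸m a≤b) eq)))
  ... | inj₂ b≤a = trans (·-∸ b≤a i) (cong (b · ψ ⟨$⟩ʳ_)
    (subst (λ c → c · ψ ⟨$⟩ʳ i ≡ i) (ℕ.m≤n⇒∣n-m∣≡n∸m b≤a) eq))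

  abstract
    finiteOrder : ∃ λ N → ∀ i → suc N · ψ ⟨$⟩ʳ i ≡ i
    finiteOrder = finite (period ψ)
      where
      finite : (∃ λ N → NonZero N × (∀ i → N · ψ ⟨$⟩ʳ i ≡ i)) → ∃ λ N → ∀ i → suc N · ψ ⟨$⟩ʳ i ≡ i
      finite (suc N , _ , eq) = N , eq

  sameOrbit⁺ : ∀ a {i j} → a · ψ ⟨$⟩ʳ i ≡ j → SameOrbit ψ i j
  sameOrbit⁺ a eq = a · ψ , (+ a , λ _ → refl) , eq

  abstract
    sameOrbit⁻ : ∀ {i j} → SameOrbit ψ i j → ∃ λ a → a · ψ ⟨$⟩ʳ i ≡ j
    sameOrbit⁻ {i} (π , p , eq) = let k , π≈ = ⟨⟩-natural {x = ψ} {π} p in k , trans (sym (π≈ i)) eq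

  sameOrbit-isEquivalence : IsEquivalence (SameOrbit ψ)
  sameOrbit-isEquivalence = record
    { refl  = sameOrbit⁺ 0 refl
    ; sym   = λ p → let a , eq = sameOrbit⁻ p in symm a eq
    ; trans = λ {i} p q → let a , eq = sameOrbit⁻ p ; b , eq′ = sameOrbit⁻ q in
        sameOrbit⁺ (a + b) (trans (·-+ ψ a b i) (trans (cong (b · ψ ⟨$⟩ʳ_) eq) eq′))
    }
    where
    symm : ∀ {i j} a → a · ψ ⟨$⟩ʳ i ≡ j → SameOrbit ψ j i
    -- `ψ` to the power `suc N` is the identity and `a + N * a = suc N * a`, so `N * a` further
    -- steps lead back to `i`.
    symm {i} a refl = let N , ψᴺ≈1 = finiteOrder in
      sameOrbit⁺ (N * a) (trans (sym (·-+ ψ a (N * a) i)) (·-∣ (suc N) (ψᴺ≈1 i) (m∣m*n a)))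

  abstract
    -- The period is written `suc p` to keep the trivial period 0 out of the search.
    minimalPeriod : ∀ i → ∃ λ p → suc p · ψ ⟨$⟩ʳ i ≡ i × (∀ l → l < p → ¬ suc l · ψ ⟨$⟩ʳ i ≡ i)
    minimalPeriod i = let N , ψᴺ≈1 = finiteOrder in
      least (λ a → (suc a · ψ ⟨$⟩ʳ i) Fin.≟ i) N (ψᴺ≈1 i)

  private
    module _ (i : Fin n) where
      p : ℕ
      p = suc (proj₁ (minimalPeriod i))

      returns : p · ψ ⟨$⟩ʳ i ≡ i
      returns = proj₁ (proj₂ (minimalPeriod i))

      minimal : ∀ l → l < proj₁ (minimalPeriod i) → ¬ suc l · ψ ⟨$⟩ʳ i ≡ i
      minimal = proj₂ (proj₂ (minimalPeriod i))

      reduce : ∀ a → a · ψ ⟨$⟩ʳ i ≡ (a % p) · ψ ⟨$⟩ʳ i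
      reduce a = trans (cong (λ c → c · ψ ⟨$⟩ʳ i) (trans (m≡m%n+[m/n]*n a p) (ℕ.+-comm (a % p) _)))
        (trans (·-+ ψ (a ℕ./ p * p) (a % p) i) (cong ((a % p) · ψ ⟨$⟩ʳ_) (·-∣ p returns (n∣m*n (a ℕ./ p)))))

      -- The remainder of `a` modulo `p` is also a return time, and minimality of `p` forces it to
      -- be 0.
      p∣ : ∀ a → a · ψ ⟨$⟩ʳ i ≡ i → p ∣ a
      p∣ a eq = m%n≡0⇒n∣m a p (below (a % p) (m%n<n a p) (trans (sym (reduce a)) eq))
        where
        below : ∀ r → r < p → r · ψ ⟨$⟩ʳ i ≡ i → r ≡ 0
        below zero    _         _   = refl
        below (suc l) (ℕ.s≤s l<p) eq = contradiction eq (minimal l l<p)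

      -- The orbit consists of the images of `i` under the powers below `p`. An exponent extracted
      -- from `SameOrbit` is determined only modulo `p`, hence the reduction in `idx`.
      card-orbit : Card {Σ (Fin n) (SameOrbit ψ i)} (_≡_ on proj₁) p
      card-orbit = record
        { index         = λ (_ , o) → idx o
        ; index-cong    = λ {(_ , o)} {(_ , o′)} → idx-cong o o′
        ; injective     = λ {(_ , o)} {(_ , o′)} → idx-inj o o′
        ; element       = λ r → (Fin.toℕ r · ψ ⟨$⟩ʳ i) , sameOrbit⁺ (Fin.toℕ r) refl
        ; index-element = λ r → let a , eq = sameOrbit⁻ (sameOrbit⁺ (Fin.toℕ r) refl) in
            Fin.toℕ-injective (trans (Fin.toℕ-fromℕ< (m%n<n a p))
              (distinct (m%n<n a p) (Fin.toℕ<n r) (trans (sym (reduce a)) eq)))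
        }
        where
        distinct : ∀ {r s} → r < p → s < p → r · ψ ⟨$⟩ʳ i ≡ s · ψ ⟨$⟩ʳ i → r ≡ s
        distinct {r} {s} r<p s<p eq = ∣∣-∣-<⇒≡ r<p s<p (p∣ ∣ r - s ∣ (·-∣-∣ r s eq))

        idx : ∀ {j} → SameOrbit ψ i j → Fin p
        idx o = Fin.fromℕ< (m%n<n (proj₁ (sameOrbit⁻ o)) p)

        idx-cong : ∀ {j k} (o : SameOrbit ψ i j) (o′ : SameOrbit ψ i k) → j ≡ k → idx o ≡ idx o′
        idx-cong o o′ refl = Fin.fromℕ<-cong _ _
          (let a , eq = sameOrbit⁻ o ; b , eq′ = sameOrbit⁻ o′ in
           distinct (m%n<n a p) (m%n<n b p) (trans (sym (reduce a)) (trans eq (trans (sym eq′) (reduce b))))) _ _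

        idx-inj : ∀ {j k} (o : SameOrbit ψ i j) (o′ : SameOrbit ψ i k) → idx o ≡ idx o′ → j ≡ k
        idx-inj o o′ eq₀ = let a , eq = sameOrbit⁻ o ; b , eq′ = sameOrbit⁻ o′ in
          trans (sym eq) (trans (reduce a) (trans
            (cong (λ c → c · ψ ⟨$⟩ʳ i) (Fin.fromℕ<-injective _ _ (m%n<n a p) (m%n<n b p) eq₀))
            (trans (sym (reduce b)) eq′)))

  card-orbitLength : ∀ i → Card {Σ (Fin n) (SameOrbit ψ i)} (_≡_ on proj₁) (orbitLength ψ i)
  card-orbitLength i = card-list (Unique.filter⁺ (sameOrbit? ψ i) (Unique.allFin⁺ n))
    (proj₂ ∘ ∈-filter⁻ (sameOrbit? ψ i) {xs = allFin n})
    (∈-filter⁺ (sameOrbit? ψ i) (∈-allFin _))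

  private
    -- The same orbit is counted by exponents and by the filtered list that defines `orbitLength`.
    p≡orbitLength : ∀ i → p i ≡ orbitLength ψ i
    p≡orbitLength i = card-unique (card-orbit i) (card-orbitLength i)

  orbitLength-∣ : ∀ a i → a · ψ ⟨$⟩ʳ i ≡ i → orbitLength ψ i ∣ a
  orbitLength-∣ a i eq = subst (_∣ a) (p≡orbitLength i) (p∣ i a eq)

  orbitLength-returns : ∀ {a i} → orbitLength ψ i ∣ a → a · ψ ⟨$⟩ʳ i ≡ i
  orbitLength-returns {a} {i} ∣a = ·-∣ (p i) (returns i) (subst (_∣ a) (sym (p≡orbitLength i)) ∣a)

  orbits : List (Fin n)
  orbits = deduplicate (sameOrbit? ψ) (allFin n)

  card-orbits : Card (SameOrbit ψ) (length orbits)
  card-orbits = card-deduplicate sameOrbit-isEquivalence (sameOrbit? ψ)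
    (λ i → Any.map (λ where refl → sameOrbit⁺ 0 refl) (∈-allFin i))

-- Types and the fixed points of powers

contribution : ℕ → ℕ → ℕ
contribution d m = if does (m ∣? d) then m else 0

-- If T is the type of ψ then fixedPoints d T is the number of fixed points of ψᵈ.
fixedPoints : ℕ → List ℕ → ℕ
fixedPoints d T = ∑ (map (contribution d) T)

fixedPoints-map : ∀ {A : Set} d (f : A → ℕ) xs →
  ℕΣ.sum (λ i → contribution d (f (lookup xs i))) ≡ fixedPoints d (map f xs)
fixedPoints-map d f []       = refl
fixedPoints-map d f (x ∷ xs) = cong₂ _+_ refl (fixedPoints-map d f xs)

contribution-∣ : ∀ {d m} → m ∣ d → contribution d m ≡ m
contribution-∣ {d} {m} m∣d with m ∣? d
... | yes _   = refl
... | no  m∤d = contradiction m∣d m∤d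

contribution-∤ : ∀ {d m} → ¬ m ∣ d → contribution d m ≡ 0
contribution-∤ {d} {m} m∤d with m ∣? d
... | yes m∣d = contradiction m∣d m∤d
... | no  _   = refl

module _ {n : ℕ} (ψ : Permutation′ n) (d : ℕ) where

  Fixed : Pred (Fin n) 0ℓ
  Fixed i = d · ψ ⟨$⟩ʳ i ≡ i

  -- Powers of `ψ` commute, so they permute the fixed points of `ψᵈ`.
  fixed-sameOrbit : ∀ {i j} → SameOrbit ψ i j → Fixed i → Fixed j
  fixed-sameOrbit {i} o eq with a , refl ← sameOrbit⁻ ψ o = trans (sym (·-+ ψ a d i))
    (trans (cong (λ c → c · ψ ⟨$⟩ʳ i) (ℕ.+-comm a d)) (trans (·-+ ψ d a i) (cong (a · ψ ⟨$⟩ʳ_) eq)))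

  -- An orbit consists of fixed points of `ψᵈ` if its length divides `d` and contains none
  -- otherwise; summing over the orbits gives the count.
  card-fixed : Card {Σ (Fin n) Fixed} (_≡_ on proj₁) (fixedPoints d (type ψ))
  card-fixed = subst (Card {Σ (Fin n) Fixed} (_≡_ on proj₁)) (fixedPoints-map d (orbitLength ψ) (orbits ψ))
    (card-Σ (𝒪.index ∘ proj₁) (λ {(i , _)} {(j , _)} i≡j → cong 𝒪.index i≡j) _ fibre)
    where
    module 𝒪 = Card (card-orbits ψ)

    Fibre : Fin (length (orbits ψ)) → Set
    Fibre k = Σ (Σ (Fin n) Fixed) λ (i , _) → 𝒪.index i ≡ k

    split : ∀ k → Dec (orbitLength ψ (𝒪.element k) ∣ d) →
            Card {Fibre k} ((_≡_ on proj₁) on proj₁) (contribution d (orbitLength ψ (𝒪.element k)))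
    split k (yes ℓ∣d) = subst (Card {Fibre k} ((_≡_ on proj₁) on proj₁)) (sym (contribution-∣ ℓ∣d))
      (card-map (card-orbitLength ψ (𝒪.element k)) (λ ((i , _) , eq) → i , 𝒪.injective (trans (𝒪.index-element k) (sym eq)))
      (λ p → p) (λ p → p)
      (λ (i , o) → ((i , fixed-sameOrbit o (orbitLength-returns ψ ℓ∣d))
                   , trans (sym (𝒪.index-cong o)) (𝒪.index-element k)) , refl))
    split k (no ℓ∤d) = subst (Card {Fibre k} ((_≡_ on proj₁) on proj₁)) (sym (contribution-∤ ℓ∤d))
      (card-empty λ ((i , eq) , ix) → ℓ∤d (orbitLength-∣ ψ d (𝒪.element k)
        (fixed-sameOrbit (𝒪.injective (trans ix (sym (𝒪.index-element k)))) eq)))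

    fibre : ∀ k → Card {Fibre k} ((_≡_ on proj₁) on proj₁) (contribution d (orbitLength ψ (𝒪.element k)))
    fibre k = split k (orbitLength ψ (𝒪.element k) ∣? d)

-- The bijection `f` matches the fixed points of `χᵉ` with those of `ψᵈ`. It is the identity for
-- powers and the inverse of the conjugator for conjugates.
fixedPoints-type : ∀ {n} (ψ χ : Permutation′ n) d e (f : Fin n → Fin n) →
  (∀ {i j} → f i ≡ f j → i ≡ j) → (∀ j → ∃ λ i → f i ≡ j) →
  (∀ i → Fixed χ e i → Fixed ψ d (f i)) → (∀ i → Fixed ψ d (f i) → Fixed χ e i) →
  fixedPoints e (type χ) ≡ fixedPoints d (type ψ)
fixedPoints-type {n} ψ χ d e f f-inj f-surj to from = card-unique (card-fixed χ e)
  (card-map {A = Σ (Fin n) (Fixed ψ d)} {B = Σ (Fin n) (Fixed χ e)} {_∼_ = _≡_ on proj₁} (card-fixed ψ d)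
    (λ (i , eq) → f i , to i eq) (cong f) f-inj
    λ (j , eq) → let i , p = f-surj j in (i , from i (subst (Fixed ψ d) (sym p) eq)) , p)

fixedPoints-↭ : ∀ d {T U} → T ↭ U → fixedPoints d T ≡ fixedPoints d U
fixedPoints-↭ d p = sum-↭ (↭.map⁺ (contribution d) p)

fixedPoints-≢0⇒∣ : ∀ d T → ¬ fixedPoints d T ≡ 0 → ∃ λ m → m ∈ T × m ∣ d
fixedPoints-≢0⇒∣ d []      ≢0 = contradiction refl ≢0
fixedPoints-≢0⇒∣ d (m ∷ T) ≢0 with m ∣? d
... | yes m∣d = m , here refl , m∣d
... | no  _   with m , m∈T , m∣d ← fixedPoints-≢0⇒∣ d T ≢0 = m , there m∈T , m∣d

fixedPoints-∈⇒≢0 : ∀ {m T} → .{{NonZero m}} → m ∈ T → ¬ fixedPoints m T ≡ 0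
fixedPoints-∈⇒≢0 {m} {T} m∈T eq with as , bs , refl ← ∈-∃++ m∈T =
  ℕ.≢-nonZero⁻¹ m (ℕ.m+n≡0⇒m≡0 m (trans (cong (_+ fixedPoints m (as ++ bs)) (sym (contribution-∣ {m} ∣-refl)))
    (trans (sym (fixedPoints-↭ m (↭.shift m as bs))) eq)))

-- The length equation supports the recursion of `fixedPoints-injective` on the number of parts.
extractMinimum : ∀ x xs → ∃ λ m → ∃ λ ys → x ∷ xs ↭ m ∷ ys × All (m ≤_) (x ∷ xs) × length ys ≡ length xs
extractMinimum x [] = x , [] , ↭-refl , ℕ.≤-refl ∷ [] , refl
extractMinimum x (y ∷ xs) with m , ys , p , m≤ , eq ← extractMinimum y xs | ℕ.≤-total x m
... | inj₁ x≤m = x , y ∷ xs , ↭-refl , ℕ.≤-refl ∷ All.map (ℕ.≤-trans x≤m) m≤ , refl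
... | inj₂ m≤x = m , x ∷ ys , ↭-trans (↭-prep x p) (↭.↭-swap x m ↭-refl) , m≤x ∷ m≤ , cong suc eq

-- The least part of T is the least positive d with fixedPoints d T ≢ 0; hence T and U
-- have the same least part, which can be split off from both.
fixedPoints-injective : ∀ {T U} → All NonZero T → All NonZero U →
  (∀ d → fixedPoints d T ≡ fixedPoints d U) → T ↭ U
fixedPoints-injective {T} = go (length T) T _ refl
  where
  go : ∀ k T U → length T ≡ k → All NonZero T → All NonZero U →
       (∀ d → fixedPoints d T ≡ fixedPoints d U) → T ↭ U
  go _ []       []      _ _ _ _ = ↭-refl
  go _ []       (u ∷ U) _ _ (u≢0 ∷ _) eq = contradiction (sym (eq u)) (fixedPoints-∈⇒≢0 {u} {u ∷ U} {{u≢0}} (here refl))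
  go (suc k) (x ∷ xs) U len T≢0 U≢0 eq
    with m , ys , p , m≤ , len′ ← extractMinimum x xs
    with m≢0 ∷ ys≢0 ← ↭.All-resp-↭ p T≢0
    with u , u∈U , u∣m ← fixedPoints-≢0⇒∣ m U
           (fixedPoints-∈⇒≢0 {m} {{m≢0}} (↭.∈-resp-↭ (↭-sym p) (here refl)) ∘ trans (eq m))
    with t , t∈T , t∣u ← fixedPoints-≢0⇒∣ u (x ∷ xs)
           (fixedPoints-∈⇒≢0 {u} {{All.lookup U≢0 u∈U}} u∈U ∘ trans (sym (eq u)))
    with refl ← ℕ.≤-antisym (∣⇒≤ {{m≢0}} u∣m) (ℕ.≤-trans (All.lookup m≤ t∈T) (∣⇒≤ {{All.lookup U≢0 u∈U}} t∣u))
    with as , bs , refl ← ∈-∃++ u∈U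
    with _ ∷ rest≢0 ← ↭.All-resp-↭ (↭.shift m as bs) U≢0
    = ↭-trans p (↭-trans (↭-prep m (go k ys (as ++ bs) (trans len′ (ℕ.suc-injective len)) ys≢0 rest≢0
        λ d → ℕ.+-cancelˡ-≡ (contribution d m) _ _ (trans (sym (fixedPoints-↭ d p))
          (trans (eq d) (fixedPoints-↭ d (↭.shift m as bs))))))
      (↭-sym (↭.shift m as bs)))

fixedPoints-++ : ∀ d T U → fixedPoints d (T ++ U) ≡ fixedPoints d T + fixedPoints d U
fixedPoints-++ d T U = trans (cong ∑ (map-++ (contribution d) T U)) (sum-++ (map (contribution d) T) _)

fixedPoints-replicate : ∀ d k m → fixedPoints d (replicate k m) ≡ k * contribution d m
fixedPoints-replicate d zero    m = refl
fixedPoints-replicate d (suc k) m = cong₂ _+_ refl (fixedPoints-replicate d k m)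

module _ (a : ℕ) .{{_ : NonZero a}} where

  -- With `g = gcd a m`, the `g` parts `m/g` contribute `m` in total exactly when `m/g ∣ d`, which
  -- is equivalent to `m ∣ a * d`.
  fixedPoints-powerOfPart : ∀ d m → fixedPoints d (powerOfPart a m) ≡ contribution (a * d) m
  fixedPoints-powerOfPart d m = trans (fixedPoints-replicate d g m/g) (split (m/g ∣? d))
    where
    g = gcd a m
    instance g≢0 = gcd-nonZero a m
    m/g = m ℕ./ g

    g*m/g : g * m/g ≡ m
    g*m/g = m*[n/m]≡n (gcd[m,n]∣n a m)

    forth : m/g ∣ d → m ∣ a * d
    forth p = subst (_∣ a * d) g*m/g (*-pres-∣ (gcd[m,n]∣m a m) p)

    -- Cancelling `g` leaves `m/g` dividing `(a/g) * d`, and `a/g` is coprime to `m/g`.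
    back : m ∣ a * d → m/g ∣ d
    back p = Coprimality.coprime-divisor (Coprimality.sym (Coprimality.coprime-/gcd a m))
      (*-cancelˡ-∣ g (≡.subst₂ _∣_ (sym g*m/g)
        (trans (cong (_* d) (sym (m*[n/m]≡n (gcd[m,n]∣m a m)))) (ℕ.*-assoc g (a ℕ./ g) d)) p))

    split : Dec (m/g ∣ d) → g * contribution d m/g ≡ contribution (a * d) m
    split (yes p) = trans (cong (g *_) (contribution-∣ p)) (trans g*m/g (sym (contribution-∣ (forth p))))
    split (no ¬p) = trans (cong (g *_) (contribution-∤ ¬p)) (trans (ℕ.*-zeroʳ g) (sym (contribution-∤ (¬p ∘ back))))

  fixedPoints-^ᵀ : ∀ d T → fixedPoints d (T ^ᵀ a) ≡ fixedPoints (a * d) T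
  fixedPoints-^ᵀ d []      = refl
  fixedPoints-^ᵀ d (m ∷ T) = trans (fixedPoints-++ d (powerOfPart a m) (T ^ᵀ a))
    (cong₂ _+_ (fixedPoints-powerOfPart d m) (fixedPoints-^ᵀ d T))

  ^ᵀ-nonZero : ∀ {T} → All NonZero T → All NonZero (T ^ᵀ a)
  ^ᵀ-nonZero [] = []
  ^ᵀ-nonZero {m ∷ T} (m≢0 ∷ T≢0) = All.++⁺
    (All.replicate⁺ (gcd a m) (ℕ.≢-nonZero (n/gcd[m,n]≢0 a m {{m≢0}} {{gcd-nonZero a m}})))
    (^ᵀ-nonZero T≢0)

-- Types of powers and of conjugates

module _ {n : ℕ} (ψ : Permutation′ n) where

  -- Both lists have the same fixed-point numbers by `fixedPoints-^ᵀ`, and these determine a list of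
  -- nonzero parts.
  type-power : ∀ χ a → (∀ d i → d · χ ⟨$⟩ʳ i ≡ (suc a * d) · ψ ⟨$⟩ʳ i) → type χ ↭ type ψ ^ᵀ suc a
  type-power χ a power = fixedPoints-injective (type-nonZero χ) (^ᵀ-nonZero (suc a) (type-nonZero ψ)) λ d →
    trans (fixedPoints-type ψ χ (suc a * d) d (λ i → i) (λ p → p) (λ i → i , refl)
        (λ i eq → trans (sym (power d i)) eq) (λ i eq → trans (power d i) eq))
      (sym (fixedPoints-^ᵀ (suc a) d (type ψ)))

  type-· : ∀ a → type (suc a · ψ) ↭ type ψ ^ᵀ suc a
  type-· a = type-power (suc a · ψ) a λ d i →
    trans (·-* ψ d (suc a) i) (cong (λ c → c · ψ ⟨$⟩ʳ i) (ℕ.*-comm d (suc a)))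

  -- By definition the product `x ⁻¹ ∙ ψ ∙ x` that occurs in `FusionControlled` and `Normalizes`.
  conj : Permutation′ n → Permutation′ n
  conj x = (Perm.flip x ∘ₚ ψ) ∘ₚ x

module _ {n : ℕ} (ψ x : Permutation′ n) where

  conj-· : ∀ d i → d · conj ψ x ⟨$⟩ʳ i ≡ x ⟨$⟩ʳ (d · ψ ⟨$⟩ʳ (x ⟨$⟩ˡ i))
  conj-· zero    i = sym (Perm.inverseʳ x)
  conj-· (suc d) i = trans (conj-· d _) (cong (λ j → x ⟨$⟩ʳ (d · ψ ⟨$⟩ʳ j)) (Perm.inverseˡ x))

  -- The inverse of `x` maps the fixed points of each power of `conj ψ x` onto those of the same
  -- power of `ψ`.
  type-conj : type (conj ψ x) ↭ type ψ
  type-conj = fixedPoints-injective (type-nonZero (conj ψ x)) (type-nonZero ψ) λ d →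
    fixedPoints-type ψ (conj ψ x) d d (x ⟨$⟩ˡ_) (⟨$⟩ʳ-injective (Perm.flip x))
      (λ i → x ⟨$⟩ʳ i , Perm.inverseˡ x)
      (λ i eq → ⟨$⟩ʳ-injective x (trans (sym (conj-· d i)) (trans eq (sym (Perm.inverseʳ x)))))
      (λ i eq → trans (conj-· d i) (trans (cong (x ⟨$⟩ʳ_) eq) (Perm.inverseʳ x)))

-- Conjugacy in the symmetric group

-- If `f` missed `i`, punching out `i` would inject `Fin (suc n)` into `Fin n`.
injective⇒surjective : ∀ {n} (f : Fin n → Fin n) → (∀ {i j} → f i ≡ f j → i ≡ j) → ∀ i → ∃ λ j → f j ≡ i
injective⇒surjective {suc n} f f-inj i with Fin.any? (λ j → f j Fin.≟ i)
... | yes found = found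
... | no  none  = contradiction
  (Fin.injective⇒≤ {f = λ j → Fin.punchOut {i = i} (none ∘ (j ,_) ∘ sym)}
    (λ {j} {k} → f-inj ∘ Fin.punchOut-injective (none ∘ (j ,_) ∘ sym) (none ∘ (k ,_) ∘ sym)))
  ℕ.1+n≰n

injective⇒permutation : ∀ {n} (f : Fin n → Fin n) → (∀ {i j} → f i ≡ f j → i ≡ j) →
  ∃ λ (x : Permutation′ n) → ∀ i → x ⟨$⟩ʳ i ≡ f i
injective⇒permutation f f-inj =
  Perm.permutation f (proj₁ ∘ onto) (proj₂ ∘ onto) (λ i → f-inj (proj₂ (onto (f i)))) , λ _ → refl
  where onto = injective⇒surjective f f-inj

module _ {A : Set} where

  lookup-map : ∀ (f : A → ℕ) xs i → lookup (map f xs) i ≡ f (lookup xs (Fin.cast (length-map f xs) i))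
  lookup-map f (x ∷ xs) zero    = refl
  lookup-map f (x ∷ xs) (suc i) = lookup-map f xs i

  -- The bijection of positions underlying `p` is transported by casts from the mapped lists to `xs`
  -- and `ys`.
  ↭-match : ∀ (f g : A → ℕ) xs ys → map f xs ↭ map g ys →
            ∃ λ (σ : Fin (length xs) → Fin (length ys)) →
            (∀ {i j} → σ i ≡ σ j → i ≡ j) × (∀ i → f (lookup xs i) ≡ g (lookup ys (σ i)))
  ↭-match f g xs ys p = σ , (λ eq → cast-injective (sym lx) (⟨$⟩ʳ-injective π (cast-injective ly eq))) , λ i →
    trans (cong (f ∘ lookup xs) (sym (Fin.cast-involutive lx (sym lx) i))) (trans (sym (lookup-map f xs _))
      (trans (↭ₛ.onIndices-lookup (≡.setoid ℕ) (↭⇒↭ₛ p) _) (lookup-map g ys _)))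
    where
    lx = length-map f xs
    ly = length-map g ys
    π = onIndices (↭⇒↭ₛ p)

    σ : Fin (length xs) → Fin (length ys)
    σ i = Fin.cast ly (π ⟨$⟩ʳ Fin.cast (sym lx) i)

    cast-injective : ∀ {m n} (eq : m ≡ n) {i j : Fin m} → Fin.cast eq i ≡ Fin.cast eq j → i ≡ j
    cast-injective eq {i} {j} p = trans (sym (Fin.cast-involutive (sym eq) eq i))
      (trans (cong (Fin.cast (sym eq)) p) (Fin.cast-involutive (sym eq) eq j))

-- Two powers agree at a point exactly when the orbit length divides the distance of their
-- exponents, a condition in which only the length enters.
orbitLength-transfer : ∀ {n} (ψ χ : Permutation′ n) {i j} → orbitLength ψ i ≡ orbitLength χ j →
  ∀ a b → a · ψ ⟨$⟩ʳ i ≡ b · ψ ⟨$⟩ʳ i → a · χ ⟨$⟩ʳ j ≡ b · χ ⟨$⟩ʳ j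
orbitLength-transfer ψ χ {i} ℓ≡ a b eq = ·-∣-∣⁻ χ a b
  (orbitLength-returns χ (subst (_∣ ∣ a - b ∣) ℓ≡ (orbitLength-∣ ψ ∣ a - b ∣ i (·-∣-∣ ψ a b eq))))

-- Orbits of equal length are matched, and within an orbit ψᵃ r is sent to χᵃ s,
-- where r and s are the representatives of the matched orbits.
module _ {n : ℕ} (ψ χ : Permutation′ n)
         (σ : Fin (length (orbits ψ)) → Fin (length (orbits χ)))
         (σ-inj : ∀ {i j} → σ i ≡ σ j → i ≡ j)
         (σ-length : ∀ k → orbitLength ψ (lookup (orbits ψ) k) ≡ orbitLength χ (lookup (orbits χ) (σ k))) where

  private
    module Ψ = Card (card-orbits ψ)
    module Χ = Card (card-orbits χ)

    base : Fin n → Fin n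
    base i = Ψ.element (Ψ.index i)

    target : Fin n → Fin n
    target i = Χ.element (σ (Ψ.index i))

    offset : ∀ i → ∃ λ a → a · ψ ⟨$⟩ʳ base i ≡ i
    offset i = sameOrbit⁻ ψ (Ψ.injective (Ψ.index-element (Ψ.index i)))

    f : Fin n → Fin n
    f i = proj₁ (offset i) · χ ⟨$⟩ʳ target i

    -- Any exponent leading from the base point to `j` may replace the one chosen by `offset`:
    -- exponents that agree on an orbit of `ψ` agree on the matched orbit of `χ`.
    f-index : ∀ {i j} → Ψ.index i ≡ Ψ.index j → ∀ a → a · ψ ⟨$⟩ʳ base i ≡ j → f j ≡ a · χ ⟨$⟩ʳ target i
    f-index {i} {j} eq a p = trans (cong (λ k → proj₁ (offset j) · χ ⟨$⟩ʳ Χ.element (σ k)) (sym eq))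
      (orbitLength-transfer ψ χ (σ-length (Ψ.index i)) (proj₁ (offset j)) a
        (trans (cong (λ k → proj₁ (offset j) · ψ ⟨$⟩ʳ Ψ.element k) eq) (trans (proj₂ (offset j)) (sym p))))

    f-step : ∀ i → f (ψ ⟨$⟩ʳ i) ≡ χ ⟨$⟩ʳ f i
    f-step i = trans
      (f-index {i} {ψ ⟨$⟩ʳ i} (Ψ.index-cong (sameOrbit⁺ ψ 1 refl)) (a + 1)
        (trans (·-+ ψ a 1 (base i)) (cong (ψ ⟨$⟩ʳ_) (proj₂ (offset i)))))
      (·-+ χ a 1 (target i))
      where a = proj₁ (offset i)

    -- Equal images lie in one orbit of `χ`, so by injectivity of `σ` the points lie in one orbit of
    -- `ψ`; there the transfer from `χ` back to `ψ` compares the exponents.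
    f-injective : ∀ {i j} → f i ≡ f j → i ≡ j
    f-injective {i} {j} eq = trans (sym (proj₂ (offset i))) (trans
      (orbitLength-transfer χ ψ (sym (σ-length (Ψ.index i))) a b
        (trans eq (cong (λ k → b · χ ⟨$⟩ʳ Χ.element (σ k)) (sym same))))
      (trans (cong (λ k → b · ψ ⟨$⟩ʳ Ψ.element k) same) (proj₂ (offset j))))
      where
      a = proj₁ (offset i)
      b = proj₁ (offset j)
      module ~ = IsEquivalence (sameOrbit-isEquivalence χ)

      same : Ψ.index i ≡ Ψ.index j
      same = σ-inj (trans (sym (Χ.index-element _)) (trans
        (Χ.index-cong (~.trans (sameOrbit⁺ χ a eq) (~.sym (sameOrbit⁺ χ b refl))))
        (Χ.index-element _)))

  -- As an injective self-map of a finite set `f` is a permutation, and `f-step` says that it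
  -- intertwines `ψ` with `χ`.
  matched⇒conjugate : ∃ λ x → conj ψ x Perm.≈ χ
  matched⇒conjugate = intertwines (injective⇒permutation f f-injective)
    where
    intertwines : (∃ λ (x : Permutation′ n) → ∀ i → x ⟨$⟩ʳ i ≡ f i) → ∃ λ x → conj ψ x Perm.≈ χ
    intertwines (x , x≡f) = x , λ i → let j = x ⟨$⟩ˡ i in
      trans (x≡f (ψ ⟨$⟩ʳ j)) (trans (f-step j) (cong (χ ⟨$⟩ʳ_) (trans (sym (x≡f j)) (Perm.inverseʳ x))))

abstract
  type⇒conjugate : ∀ {n} (ψ χ : Permutation′ n) → type ψ ↭ type χ → ∃ λ x → conj ψ x Perm.≈ χ
  type⇒conjugate ψ χ p =
    let σ , σ-inj , σ-length = ↭-match (orbitLength ψ) (orbitLength χ) (orbits ψ) (orbits χ) p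
    in matched⇒conjugate ψ χ σ σ-inj σ-length

-- Generators of cyclic groups

order-least : ∀ {T a} → All (_∣ a) T → order T ∣ a
order-least []                  = 1∣ _
order-least {m ∷ T} (m∣a ∷ T∣a) = lcm-least m∣a (order-least T∣a)

order-↭ : ∀ {T U} → T ↭ U → order T ≡ order U
order-↭ {T} {U} p = ∣-antisym
  (order-least (All.tabulate (order-∣ U ∘ ↭.∈-resp-↭ p)))
  (order-least (All.tabulate (order-∣ T ∘ ↭.∈-resp-↭ (↭-sym p))))

-- The order is encoded by its multiples, which are the exponents that annihilate `ψ`.
_HasOrder_ : ∀ {n} → Permutation′ n → ℕ → Set
ψ HasOrder o = ∀ a → (o ∣ a → a · ψ Perm.≈ Perm.id) × (a · ψ Perm.≈ Perm.id → o ∣ a)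

-- A power of `ψ` is trivial when all orbit lengths divide the exponent, and `order` is their least
-- common multiple.
hasOrder-type : ∀ {n} (ψ : Permutation′ n) → ψ HasOrder order (type ψ)
hasOrder-type ψ a = forth , λ ψᵃ≈1 → order-least {type ψ} (All.map⁺ {xs = orbits ψ} (All.tabulate λ {i} _ → orbitLength-∣ ψ a i (ψᵃ≈1 i)))
  where
  module 𝒪 = Card (card-orbits ψ)

  forth : order (type ψ) ∣ a → a · ψ Perm.≈ Perm.id
  forth o∣a i = fixed-sameOrbit ψ a (𝒪.injective (𝒪.index-element (𝒪.index i))) (orbitLength-returns ψ
    (∣-trans (order-∣ (type ψ) (∈-map⁺ (orbitLength ψ) (∈-lookup (𝒪.index i)))) o∣a))

module _ {n : ℕ} (ψ : Permutation′ n) where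

  ⟨⟩⁺ : ∀ a {χ} → χ Perm.≈ a · ψ → ⟨ ψ ⟩ χ
  ⟨⟩⁺ a eq = + a , eq

  ⟨⟩-⊆ : ∀ χ → ⟨ ψ ⟩ χ → ∀ {π} → ⟨ χ ⟩ π → ⟨ ψ ⟩ π
  ⟨⟩-⊆ χ p {π} q with a , χ≈ ← ⟨⟩-natural {x = ψ} {χ} p | b , π≈ ← ⟨⟩-natural {x = χ} {π} q =
    ⟨⟩⁺ (b * a) {π} λ i → trans (π≈ i) (trans (Mult.×-congʳ (Group.monoid (Sym n)) b {χ} {a · ψ} χ≈ i) (·-* ψ b a i))

module _ {n : ℕ} (ψ : Permutation′ n) {o : ℕ} .{{_ : NonZero o}} (ord : ψ HasOrder o) where

  ·-≈⇒∣ : ∀ a b → a · ψ Perm.≈ b · ψ → o ∣ ∣ a - b ∣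
  ·-≈⇒∣ a b eq = proj₂ (ord ∣ a - b ∣) λ i → ·-∣-∣ ψ a b (eq i)

  coprime⇒generates : ∀ a → Coprime a o → ⟨ a · ψ ⟩ ψ
  coprime⇒generates a c = go (coprime-Bézout c)
    where
    identity : ∀ {k} → o ∣ k → ∀ i → k · ψ ⟨$⟩ʳ i ≡ i
    identity {k} o∣k = proj₁ (ord k) o∣k

    go : Bézout.Identity 1 a o → ⟨ a · ψ ⟩ ψ
    go (Bézout.+- x y eq) = + x , λ i → sym (trans (·-* ψ x a i) (trans (cong (λ k → k · ψ ⟨$⟩ʳ i) (sym eq))
      (trans (·-+ ψ 1 (y * o) i) (identity (n∣m*n y) _))))
    -- Here the Bézout identity is `1 + x * a = y * o`, so `ψ` is inverse to the power `x` of
    -- `a · ψ`. The case `x = 0`, in which `ψ` is trivial, is separate because `-[1+_]` gives only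
    -- negative exponents.
    go (Bézout.-+ zero y eq) = + 0 , λ i → trans (cong (λ k → k · ψ ⟨$⟩ʳ i) eq) (identity (n∣m*n y) i)
    go (Bézout.-+ (suc x) y eq) = -[1+ x ] , λ i → ⟨$⟩ʳ-injective (suc x · (a · ψ)) (trans
      (trans (·-* ψ (suc x) a (ψ ⟨$⟩ʳ i)) (trans (cong (λ k → k · ψ ⟨$⟩ʳ i) eq) (identity (n∣m*n y) i)))
      (sym (Perm.inverseʳ (suc x · (a · ψ)))))

  -- If `ψ` is the power `b * a` of itself, then `o` divides the distance from 1 to `b * a`; a
  -- common divisor of `a` and `o` therefore divides 1.
  generates⇒coprime : ∀ a → ⟨ a · ψ ⟩ ψ → Coprime a o
  generates⇒coprime a p {d} (d∣a , d∣o) with b , ψ≈ ← ⟨⟩-natural {x = a · ψ} {ψ} p =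
    ∣1⇒≡1 (divides-1 (b * a) (∣-trans d∣a (n∣m*n b))
      (∣-trans d∣o (·-≈⇒∣ 1 (b * a) λ i → trans (ψ≈ i) (·-* ψ b a i))))
    where
    divides-1 : ∀ k → d ∣ k → d ∣ ∣ 1 - k ∣ → d ∣ 1
    divides-1 zero    _ d∣1 = d∣1
    divides-1 (suc k) p q   = ∣m+n∣m⇒∣n (subst (d ∣_) (ℕ.+-comm 1 k) p) q

  private
    exponents : List ℕ
    exponents = filter (λ a → coprime? a o) (map suc (upTo o))

    ∈-exponents⁻ : ∀ {a} → a ∈ exponents → ∃ λ r → r < o × a ≡ suc r × Coprime a o
    ∈-exponents⁻ a∈ with a∈′ , c ← ∈-filter⁻ (λ a → coprime? a o) {xs = map suc (upTo o)} a∈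
      with r , r∈ , refl ← ∈-map⁻ suc a∈′ = r , ∈-upTo⁻ r∈ , refl , c

    ∈-exponents⁺ : ∀ {r} → r < o → Coprime (suc r) o → suc r ∈ exponents
    ∈-exponents⁺ r<o c = ∈-filter⁺ (λ a → coprime? a o) (∈-map⁺ suc (∈-upTo⁺ r<o)) c

    distinct : ∀ {a b} → a ∈ exponents → b ∈ exponents → a · ψ Perm.≈ b · ψ → a ≡ b
    distinct a∈ b∈ eq with r , r<o , refl , _ ← ∈-exponents⁻ a∈ | s , s<o , refl , _ ← ∈-exponents⁻ b∈ =
      cong suc (∣∣-∣-<⇒≡ r<o s<o (·-≈⇒∣ (suc r) (suc s) eq))

    exponent : ∀ χ → ⟨ χ ⟩ ≐ ⟨ ψ ⟩ → ∃ λ a → a ∈ exponents × χ Perm.≈ a · ψ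
    exponent χ (χ⊆ψ , ψ⊆χ) with k , χ≈ ← ⟨⟩-natural {x = ψ} {χ} (χ⊆ψ {χ} (+ 1 , λ _ → refl)) =
      suc r , ∈-exponents⁺ (m%n<n _ o) (generates⇒coprime (suc r)
        (⟨⟩-⊆ (suc r · ψ) χ (⟨⟩⁺ (suc r · ψ) 1 {χ} χ≈′) {ψ} (ψ⊆χ {ψ} (+ 1 , λ _ → refl)))) , χ≈′
      where
      -- Adding `o - 1` before reducing makes `suc r` the representative of `k` modulo `o` in the
      -- range from 1 to `o`, the range over which `φ` counts.
      r = (k + ℕ.pred o) % o

      k+o≡ : k + o ≡ suc r + (k + ℕ.pred o) ℕ./ o * o
      k+o≡ = trans (cong (λ c → k + c) (sym (ℕ.suc-pred o)))
        (trans (ℕ.+-suc k (ℕ.pred o)) (cong suc (m≡m%n+[m/n]*n (k + ℕ.pred o) o)))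

      absorb : ∀ a b → o ∣ b → ∀ i → (a + b) · ψ ⟨$⟩ʳ i ≡ a · ψ ⟨$⟩ʳ i
      absorb a b o∣b i = trans (·-+ ψ a b i) (proj₁ (ord b) o∣b _)

      χ≈′ : χ Perm.≈ suc r · ψ
      χ≈′ i = trans (χ≈ i) (trans (sym (absorb k o ∣-refl i))
        (trans (cong (λ c → c · ψ ⟨$⟩ʳ i) k+o≡) (absorb (suc r) _ (n∣m*n ((k + ℕ.pred o) ℕ./ o)) i)))

  -- The generators of the cyclic group of `ψ` are its powers with exponent from 1 to `o` coprime to
  -- `o`, and these are pairwise distinct.
  card-generators : Card {Σ (Permutation′ n) λ χ → ⟨ χ ⟩ ≐ ⟨ ψ ⟩} (Perm._≈_ on proj₁) (φ o)
  card-generators = card-map {A = Σ ℕ (_∈ exponents)} {_≈_ = _≡_ on proj₁}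
    (card-list (Unique.filter⁺ (λ a → coprime? a o) (Unique.map⁺ ℕ.suc-injective (Unique.upTo⁺ o)))
      (λ p → p) (λ p → p))
    (λ (χ , g) → let a , a∈ , _ = exponent χ g in a , a∈)
    (λ {(χ , g)} {(χ′ , g′)} χ≈χ′ → let a , a∈ , eq = exponent χ g ; b , b∈ , eq′ = exponent χ′ g′ in
      distinct a∈ b∈ λ i → trans (sym (eq i)) (trans (χ≈χ′ i) (eq′ i)))
    (λ {(χ , g)} {(χ′ , g′)} a≡b i → let a , a∈ , eq = exponent χ g ; b , b∈ , eq′ = exponent χ′ g′ in
      trans (eq i) (trans (cong (λ c → c · ψ ⟨$⟩ʳ i) a≡b) (sym (eq′ i))))
    λ (a , a∈) → let r , _ , a≡ , c = ∈-exponents⁻ a∈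
                     g = (λ {π} → ⟨⟩-⊆ ψ (a · ψ) (⟨⟩⁺ ψ a {a · ψ} λ _ → refl) {π})
                       , (λ {π} → ⟨⟩-⊆ (a · ψ) ψ (coprime⇒generates a c) {π})
                     b , b∈ , eq = exponent (a · ψ) g
                 in (a · ψ , g) , distinct b∈ a∈ (λ i → sym (eq i))

-- Components of the power graphs

module _ (X : FinSet) (R : Rel (FinSet.Carrier X) 0ℓ) where
  open FinSet X

  -- This is Graph.Connected (mkGraph X R _ _).
  Joined : Rel Carrier 0ℓ
  Joined = Star λ x y → x ≈ y ⊎ ¬ (x ≈ y) × (R x y ⊎ R y x)

  -- Adjacency demands distinct vertices, so related vertices that are equal are joined by an
  -- equality step instead.
  related⇒joined : ∀ x y → R x y → Joined x y
  related⇒joined x y r = join (x ≟ y)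
    where
    join : Dec (x ≈ y) → Joined x y
    join (yes x≈y) = inj₁ x≈y ◅ ε
    join (no  x≉y) = inj₂ (x≉y , inj₁ r) ◅ ε

  -- Connectedness is the least equivalence relation containing `_≈_` and `R`. Maps between the
  -- components of different graphs arise by choosing `S`.
  joined-fold : (S : Rel Carrier 0ℓ) → IsEquivalence S → (∀ x y → x ≈ y → S x y) → (∀ x y → R x y → S x y) →
                ∀ {x y} → Joined x y → S x y
  joined-fold S S-eq ≈⇒S R⇒S = fold
    where
    module S = IsEquivalence S-eq

    fold : ∀ {x y} → Joined x y → S x y
    fold ε                        = S.refl
    fold (inj₁ x≈y ◅ c)            = S.trans (≈⇒S _ _ x≈y) (fold c)
    fold (inj₂ (_ , inj₁ xRy) ◅ c) = S.trans (R⇒S _ _ xRy) (fold c)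
    fold (inj₂ (_ , inj₂ yRx) ◅ c) = S.trans (S.sym (R⇒S _ _ yRx)) (fold c)

module _ {n : ℕ} where

  ∈⟨⟩-self : (ψ : Permutation′ n) → ⟨ ψ ⟩ ψ
  ∈⟨⟩-self ψ = + 1 , λ _ → refl

  ⟨⟩≐⁺ : (ψ χ : Permutation′ n) → ⟨ ψ ⟩ χ → ⟨ χ ⟩ ψ → ⟨ χ ⟩ ≐ ⟨ ψ ⟩
  ⟨⟩≐⁺ ψ χ p q = (λ {π} → ⟨⟩-⊆ ψ χ p {π}) , (λ {π} → ⟨⟩-⊆ χ ψ q {π})

  conj-cong : (ψ χ x : Permutation′ n) → ψ Perm.≈ χ → conj ψ x Perm.≈ conj χ x
  conj-cong ψ χ x eq i = cong (x ⟨$⟩ʳ_) (eq (x ⟨$⟩ˡ i))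

  conj-injective : (ψ χ x : Permutation′ n) → conj ψ x Perm.≈ conj χ x → ψ Perm.≈ χ
  conj-injective ψ χ x eq i = trans (cong (ψ ⟨$⟩ʳ_) (sym (Perm.inverseˡ x))) (trans
    (⟨$⟩ʳ-injective x (eq (x ⟨$⟩ʳ i))) (cong (χ ⟨$⟩ʳ_) (Perm.inverseˡ x)))

  conj-power : (ψ χ x : Permutation′ n) (a : ℕ) → ψ Perm.≈ a · χ → conj ψ x Perm.≈ a · conj χ x
  conj-power ψ χ x a eq i = trans (conj-cong ψ (a · χ) x eq i) (sym (conj-· χ x a i))

  conj-power⁻ : (ψ χ x : Permutation′ n) (a : ℕ) → conj ψ x Perm.≈ a · conj χ x → ψ Perm.≈ a · χ
  conj-power⁻ ψ χ x a eq = conj-injective ψ (a · χ) x λ i → trans (eq i) (conj-· χ x a i)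

  conj-∈⟨⟩⁻ : (ψ χ x : Permutation′ n) → ⟨ conj χ x ⟩ (conj ψ x) → ⟨ χ ⟩ ψ
  conj-∈⟨⟩⁻ ψ χ x p = let a , eq = ⟨⟩-natural {x = conj χ x} {conj ψ x} p in
    ⟨⟩⁺ χ a {ψ} (conj-power⁻ ψ χ x a eq)

-- A record, so that the type checker compares permutations without unfolding their types.
record _HasType_ {n : ℕ} (ψ : Permutation′ n) (T : List ℕ) : Set where
  constructor hasType
  field type-↭ : type ψ ↭ T

open _HasType_

module _ {n : ℕ} where

  hasType-cong : ∀ {T} (ψ χ : Permutation′ n) → ψ Perm.≈ χ → χ HasType T → ψ HasType T
  hasType-cong ψ χ eq (hasType p) = hasType (↭-trans (↭-reflexive (type-cong-≈ {ψ = ψ} {χ} eq)) p)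

  hasType-≐ : ∀ {T} (ψ χ : Permutation′ n) → ⟨ ψ ⟩ ≐ ⟨ χ ⟩ → χ HasType T → ψ HasType T
  hasType-≐ ψ χ eq (hasType p) = hasType (↭-trans (↭-reflexive (type-cong {ψ = ψ} {χ} eq)) p)

  hasType-order : ∀ {T} (ψ : Permutation′ n) → ψ HasType T → ψ HasOrder order T
  hasType-order ψ (hasType p) = subst (ψ HasOrder_) (order-↭ p) (hasOrder-type ψ)

  hasType-↭ : ∀ {T U} {ψ : Permutation′ n} → ψ HasType T → T ↭ U → ψ HasType U
  hasType-↭ (hasType p) q = hasType (↭-trans p q)

  hasType-unique : ∀ {T U} {ψ : Permutation′ n} → ψ HasType T → ψ HasType U → T ↭ U
  hasType-unique (hasType p) (hasType q) = ↭-trans (↭-sym p) q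

  hasType-· : ∀ {T} (ψ : Permutation′ n) a → ψ HasType T → (suc a · ψ) HasType (T ^ᵀ suc a)
  hasType-· ψ a (hasType p) = hasType (↭-trans (type-· ψ a) (concatMap-↭ (powerOfPart (suc a)) p))

  hasType-conj : ∀ {T} (ψ x : Permutation′ n) → ψ HasType T → conj ψ x HasType T
  hasType-conj ψ x (hasType p) = hasType (↭-trans (type-conj ψ x) p)

  hasType⇒conjugate : ∀ {T} (ψ χ : Permutation′ n) → ψ HasType T → χ HasType T → ∃ λ x → conj ψ x Perm.≈ χ
  hasType⇒conjugate ψ χ (hasType p) (hasType q) = type⇒conjugate ψ χ (↭-trans p (↭-sym q))

  -- Equal types mean conjugate, and only the identity is conjugate to the identity. This lets
  -- `ofType` conclude from the type that an element is nontrivial.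
  hasType-id : ∀ {T} (ψ χ : Permutation′ n) → ψ HasType T → χ HasType T → ψ Perm.≈ Perm.id → χ Perm.≈ Perm.id
  hasType-id ψ χ p q ψ≈1 i = let x , eq = hasType⇒conjugate ψ χ p q in
    trans (sym (eq i)) (trans (cong (x ⟨$⟩ʳ_) (ψ≈1 (x ⟨$⟩ˡ i))) (Perm.inverseʳ x))

module PowerGraphs {n : ℕ} (G : Subgroup n) where
  open Subgroup G

  P₀ = properPowerGraph G
  P̃₀ = properQuotientPowerGraph G
  P₀𝒯 = properPowerTypeGraph G
  module P₀ = IsEquivalence (Graph.Connected-isEquivalence P₀)
  module P₀𝒯 = IsEquivalence (Graph.Connected-isEquivalence P₀𝒯)

  perm : G₀ G → Permutation′ n
  perm = ⌊_⌋ G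

  infix 4 _~_ _~𝒯_

  _~_ : Rel (G₀ G) 0ℓ
  _~_ = Graph.Connected P₀

  _~𝒯_ : Rel (𝒯₀ G) 0ℓ
  _~𝒯_ = Graph.Connected P₀𝒯

  power⇒~ : ∀ x y m → perm x Perm.≈ suc m · perm y → x ~ y
  power⇒~ x y m eq = related⇒joined (nonIdentity G) (_IsPositivePowerOf_ on perm) x y (m , eq)

  ≈⇒~ : ∀ x y → perm x Perm.≈ perm y → x ~ y
  ≈⇒~ x y eq = inj₁ eq ◅ ε

  ~-fold : (S : Rel (G₀ G) 0ℓ) → IsEquivalence S → (∀ x y → perm x Perm.≈ perm y → S x y) →
           (∀ x y m → perm x Perm.≈ suc m · perm y → S x y) → ∀ x y → x ~ y → S x y
  ~-fold S S-eq ≈⇒S R⇒S x y = joined-fold (nonIdentity G) (_IsPositivePowerOf_ on perm) S S-eq ≈⇒S λ x y (m , eq) → R⇒S x y m eq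

  -- A generator is a natural power of any other generator, and exponent 0 is excluded because `x`
  -- is not the identity.
  ≋⇒~ : ∀ x y → _≋_ G x y → x ~ y
  ≋⇒~ x y (x⊆y , _) = natural (⟨⟩-natural {x = perm y} {perm x} (x⊆y {perm x} (∈⟨⟩-self (perm x))))
    where
    natural : (∃ λ k → perm x Perm.≈ k · perm y) → x ~ y
    natural (zero  , eq) = contradiction eq (proj₂ x)
    natural (suc m , eq) = power⇒~ x y m eq

  ~⇒quotient : ∀ x y → x ~ y → Graph.Connected P̃₀ x y
  ~⇒quotient = ~-fold (Graph.Connected P̃₀) (Graph.Connected-isEquivalence P̃₀)
    (λ x y eq → inj₁ (⟨⟩-cong {x = perm x} {perm y} eq) ◅ ε)
    (λ x y m eq → related⇒joined (cyclicClasses G) (_IsClassPowerOf_ G) x y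
      (x , y , ≋.refl {x} , ≋.refl {y} , m , eq))
    where module ≋ = IsEquivalence (≋-isEquivalence G)

  -- A quotient edge is a power relation between some representatives, and `≋⇒~` joins those to the
  -- given ones.
  quotient⇒~ : ∀ x y → Graph.Connected P̃₀ x y → x ~ y
  quotient⇒~ _ _ = joined-fold (cyclicClasses G) (_IsClassPowerOf_ G) _~_ (Graph.Connected-isEquivalence P₀) ≋⇒~
    λ x y (x′ , y′ , x′≋x , y′≋y , m , eq) →
      P₀.trans (P₀.sym (≋⇒~ x′ x x′≋x)) (P₀.trans (power⇒~ x′ y′ m eq) (≋⇒~ y′ y y′≋y))

  abstract
    τ : G₀ G → 𝒯₀ G
    τ x = type (perm x) , x , ↭-refl

    τ-type : ∀ x → perm x HasType proj₁ (τ x)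
    τ-type x = hasType ↭-refl

  hasType⁺ : ∀ x {T} → type (⌊_⌋ G x) ↭ T → perm x HasType T
  hasType⁺ x = hasType

  hasType⁻ : ∀ x {T} → perm x HasType T → type (⌊_⌋ G x) ↭ T
  hasType⁻ x (hasType p) = p

  witness : ∀ (V : 𝒯₀ G) → ∃ λ v → perm v HasType proj₁ V
  witness (_ , v , p) = v , hasType⁺ v p

  typePower⇒~ : ∀ U V a → proj₁ U ↭ proj₁ V ^ᵀ suc a → U ~𝒯 V
  typePower⇒~ U V a p = related⇒joined (types G) (_IsTypePowerOf_ on proj₁) U V (a , p)

  ~⇒~𝒯 : ∀ x y → x ~ y → τ x ~𝒯 τ y
  ~⇒~𝒯 = ~-fold (_~𝒯_ on τ) (On.isEquivalence τ (Graph.Connected-isEquivalence P₀𝒯)) step₁ step₂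
    where
    step₁ : ∀ x y → perm x Perm.≈ perm y → τ x ~𝒯 τ y
    step₁ x y eq = inj₁ (hasType-unique (τ-type x) (hasType-cong (perm x) (perm y) eq (τ-type y))) ◅ ε

    step₂ : ∀ x y m → perm x Perm.≈ suc m · perm y → τ x ~𝒯 τ y
    step₂ x y m eq = typePower⇒~ (τ x) (τ y) m (hasType-unique (τ-type x)
      (hasType-cong (perm x) (suc m · perm y) eq (hasType-· (perm y) m (τ-type y))))

  member-· : ∀ a ψ → member ψ → member (a · ψ)
  member-· zero    ψ ψ∈G = 1-closed
  member-· (suc a) ψ ψ∈G = ∙-closed ψ∈G (member-· a ψ ψ∈G)

  ofType : ∀ (V : 𝒯₀ G) ψ → member ψ → ψ HasType proj₁ V → G₀ G
  ofType V ψ ψ∈G q = (ψ , ψ∈G) , λ ψ≈1 → let v , p = witness V in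
    proj₂ v (hasType-id ψ (perm v) q p ψ≈1)

-- Fusion controlled groups

module _ {n : ℕ} (G : Subgroup n) (fusion : FusionControlled G) where
  open Subgroup G
  open PowerGraphs G
  open _HasType_

  Lift : G₀ G → List ℕ → Set
  Lift x V = ∃ λ y → x ~ y × perm y HasType V

  lift-↓ : ∀ x U (V : 𝒯₀ G) a → perm x HasType U → proj₁ V ↭ U ^ᵀ suc a → Lift x (proj₁ V)
  lift-↓ x U V a xU VU = y , P₀.sym (power⇒~ y x a λ _ → refl) , yV
    where
    yV : (suc a · perm x) HasType proj₁ V
    yV = hasType-↭ (hasType-· (perm x) a xU) (↭-sym VU)

    y : G₀ G
    y = ofType V (suc a · perm x) (member-· (suc a) (perm x) (proj₂ (proj₁ x))) yV

  -- Equal types give a conjugator `g` in the symmetric group; fusion control replaces it by an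
  -- element of the normalizer with the same effect on `ψ`.
  fuse : ∀ {T} ψ χ → member ψ → member χ → ψ HasType T → χ HasType T →
         ∃ λ h → Normalizes G h × conj ψ h Perm.≈ χ
  fuse ψ χ ψ∈G χ∈G ψT χT =
    let g , eq = hasType⇒conjugate ψ χ ψT χT
        h , norm , eq′ = fusion ψ g ψ∈G (resp-≈ {χ} {conj ψ g} (λ i → sym (eq i)) χ∈G)
    in h , norm , λ i → trans (sym (eq′ i)) (eq i)

  -- Here vᵃ and x have the same type for some v of type V, so they are conjugate under
  -- N(G), and the corresponding conjugate of v has x as a power.
  lift-↑ : ∀ x U (V : 𝒯₀ G) a → perm x HasType U → U ↭ proj₁ V ^ᵀ suc a → Lift x (proj₁ V)
  lift-↑ x U V a xU UV = conjugate (witness V)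
    where
    conjugate : (∃ λ v → perm v HasType proj₁ V) → Lift x (proj₁ V)
    conjugate (v , vV) = let h , norm , eq = fused in
      ofType V (conj (perm v) h) (Equivalence.to (norm (perm v)) (proj₂ (proj₁ v))) (hasType-conj (perm v) h vV)
      , power⇒~ x _ a (λ i → trans (sym (eq i)) (conj-power (suc a · perm v) (perm v) h (suc a) (λ _ → refl) i))
      , hasType-conj (perm v) h vV
      where
      fused : ∃ λ h → Normalizes G h × conj (suc a · perm v) h Perm.≈ perm x
      fused = fuse (suc a · perm v) (perm x) (member-· (suc a) (perm v) (proj₂ (proj₁ v))) (proj₂ (proj₁ x))
        (hasType-· (perm v) a vV) (hasType-↭ xU UV)

  lift : ∀ {U V} → U ~𝒯 V → ∀ x → perm x HasType proj₁ U → Lift x (proj₁ V)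
  lift ε x xU = x , P₀.refl , xU
  lift (_◅_ {i = U} {j = W} s c) x xU = continue (step s)
    where
    step : Graph.Step P₀𝒯 U W → Lift x (proj₁ W)
    step (inj₁ U↭W)                = x , P₀.refl , hasType-↭ xU U↭W
    step (inj₂ (_ , inj₁ (a , p))) = lift-↑ x (proj₁ U) W a xU p
    step (inj₂ (_ , inj₂ (a , p))) = lift-↓ x (proj₁ U) W a xU p

    continue : Lift x (proj₁ W) → Lift x _
    continue (y , x~y , yW) = let z , y~z , zV = lift c y yW in z , P₀.trans x~y y~z , zV

  module _ (h : Permutation′ n) (norm : Normalizes G h) where

    act : G₀ G → G₀ G
    act x = (conj (perm x) h , Equivalence.to (norm (perm x)) (proj₂ (proj₁ x))) , λ eq →
      proj₂ x (conj-injective (perm x) Perm.id h λ i → trans (eq i) (sym (Perm.inverseʳ h)))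

    act-~ : ∀ x y → x ~ y → act x ~ act y
    act-~ = ~-fold (_~_ on act) (On.isEquivalence act (Graph.Connected-isEquivalence P₀))
      (λ x y eq → ≈⇒~ (act x) (act y) (conj-cong (perm x) (perm y) h eq))
      (λ x y m eq → power⇒~ (act x) (act y) m (conj-power (perm x) (perm y) h (suc m) eq))

    act-injective : ∀ x y → _≋_ G (act x) (act y) → _≋_ G x y
    act-injective x y (⊆ , ⊇) = ⟨⟩≐⁺ (perm y) (perm x)
      (conj-∈⟨⟩⁻ (perm x) (perm y) h (⊆ {perm (act x)} (∈⟨⟩-self (perm (act x)))))
      (conj-∈⟨⟩⁻ (perm y) (perm x) h (⊇ {perm (act y)} (∈⟨⟩-self (perm (act y)))))

  -- Counting classes and components over a type

  Vertices : G₀ G → List ℕ → Set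
  Vertices C T = Σ (G₀ G) λ x → C ~ x × perm x HasType T

  card-vertices : ∀ C T → Card {Vertices C T} (_≋_ G on proj₁) (k G C T)
  card-vertices C T = card-map {A = FinSet.Carrier V} {_≈_ = FinSet._≈_ V} {_∼_ = _≋_ G on proj₁}
    (card-∣∣ V) to (λ p → p) (λ p → p) from
    where
    V = verticesOfType G C T

    to : Vertices C T → FinSet.Carrier V
    to (x , C~x , xT) = x , ~⇒quotient C x C~x , hasType⁻ x xT

    from : ∀ v → ∃ λ x → FinSet._≈_ V (to x) v
    from (x , C~x , xT) = (x , quotient⇒~ C x C~x , hasType⁺ x xT) , IsEquivalence.refl (≋-isEquivalence G) {x}

  -- Some `h` in the normalizer carries `x` to `y`. Its action respects components and types, so it
  -- takes the vertices in question over `C` injectively to those over `D`.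
  k-≤ : ∀ C D T → Vertices C T → Vertices D T → k G C T ≤ k G D T
  k-≤ C D T (x , C~x , xT) (y , D~y , yT) =
    transport (fuse (perm x) (perm y) (proj₂ (proj₁ x)) (proj₂ (proj₁ y)) xT yT)
    where
    transport : (∃ λ h → Normalizes G h × conj (perm x) h Perm.≈ perm y) → k G C T ≤ k G D T
    transport (h , norm , eq) = card-≤ {_≈_ = _≋_ G on proj₁} {_∼_ = _≋_ G on proj₁}
      (card-vertices C T) (card-vertices D T) move
      (λ {(u , _)} {(v , _)} → act-injective h norm u v)
      where
      move : Vertices C T → Vertices D T
      move (z , C~z , zT) = act h norm z
        , P₀.trans D~y (P₀.trans (P₀.sym (≈⇒~ (act h norm x) y eq))
            (act-~ h norm x z (P₀.trans (P₀.sym C~x) C~z)))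
        , hasType-conj (perm z) h zT

  k-unique : ∀ C D T → Vertices C T → Vertices D T → k G C T ≡ k G D T
  k-unique C D T c d = ℕ.≤-antisym (k-≤ C D T c d) (k-≤ D C T d c)

  componentsOver : 𝒯₀ G → FinSet
  componentsOver T = subset (Graph.components P₀) (λ q → T ~𝒯 τ q)
    (λ {x} {y} x~y T~x → P₀𝒯.trans T~x (~⇒~𝒯 x y x~y))
    (λ q → Graph.connected? P₀𝒯 T (τ q))

  componentCount : 𝒯₀ G → ℕ
  componentCount T = ∣ componentsOver T ∣

  Over : 𝒯₀ G → Set
  Over T = Σ (G₀ G) λ q → T ~𝒯 τ q

  card-over : ∀ T → Card {Over T} (_~_ on proj₁) (componentCount T)
  card-over T = card-∣∣ (componentsOver T)

  OfType : List ℕ → Set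
  OfType T = Σ (G₀ G) λ x → perm x HasType T

  -- Each class of type `T` is sent to its component. The fibre over a component is its set of
  -- vertices of type `T`, whose size is the same as for `C` by `k-unique`.
  card-classes : ∀ T C → Vertices C (proj₁ T) → Card {OfType (proj₁ T)} (_≋_ G on proj₁) (componentCount T * k G C (proj₁ T))
  card-classes T C c = card-fibres {A = OfType (proj₁ T)} {_≈_ = _≋_ G on proj₁} {B = Over T} {_∼_ = _~_ on proj₁}
    (card-over T) over (λ {(x , _)} {(y , _)} → ≋⇒~ x y) fibre
    where
    over : OfType (proj₁ T) → Over T
    over (x , xT) = x , inj₁ (hasType-unique xT (τ-type x)) ◅ ε

    Fibre : Over T → Set
    Fibre (q , _) = Σ (OfType (proj₁ T)) λ (x , _) → x ~ q

    fibre : ∀ b → Card {Fibre b} ((_≋_ G on proj₁) on proj₁) (k G C (proj₁ T))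
    fibre (q , T~q) = subst (Card {Fibre (q , T~q)} ((_≋_ G on proj₁) on proj₁)) (k-unique q C (proj₁ T) vertex c)
      (card-map {A = Vertices q (proj₁ T)} {B = Fibre (q , T~q)} {_≈_ = _≋_ G on proj₁} {_∼_ = (_≋_ G on proj₁) on proj₁}
        (card-vertices q (proj₁ T))
        (λ ((x , xT) , x~q) → x , P₀.sym x~q , xT) (λ p → p) (λ p → p)
        λ (x , q~x , xT) → ((x , xT) , P₀.sym q~x) , IsEquivalence.refl (≋-isEquivalence G) {x})
      where
      vertex : Vertices q (proj₁ T)
      -- The walk from `τ q` back to `T` lifts to a walk from `q`, so the component of `q` does
      -- contain an element of type `T`.
      vertex = lift (P₀𝒯.sym T~q) q (τ-type q)

  Elements : List ℕ → Set
  Elements T = Σ (Σ (Permutation′ n) member) λ (x , _) → x HasType T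

  _≈ᴱ_ : ∀ {T} → Rel (Elements T) 0ℓ
  ((x , _) , _) ≈ᴱ ((y , _) , _) = x Perm.≈ y

  card-μ : ∀ T → Card {Elements T} _≈ᴱ_ (μ G T)
  card-μ T = card-map {A = FinSet.Carrier X} {_≈_ = FinSet._≈_ X} {_∼_ = _≈ᴱ_} (card-∣∣ X)
    (λ (x , xT) → x , type-↭ xT) (λ p → p) (λ p → p)
    λ (x , xT) → (x , hasType xT) , λ _ → refl
    where
    X = subset (elementsOf G) (λ (x , _) → type x ↭ T)
      (λ {(x , _)} {(y , _)} x≈y p → ↭-trans (↭-reflexive (sym (type-cong-≈ {ψ = x} {y} x≈y))) p)
      (λ (x , _) → type x ↭? T)

  -- Each element is sent to the class of its cyclic group. The fibre consists of the generators of
  -- that group, all of which lie in `G` and have type `T`.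
  card-elements : ∀ {m} (T : 𝒯₀ G) → Card {OfType (proj₁ T)} (_≋_ G on proj₁) m →
    Card {Elements (proj₁ T)} _≈ᴱ_ (m * φ (order (proj₁ T)))
  card-elements T classes = card-fibres {A = Elements (proj₁ T)} {_≈_ = _≈ᴱ_} {B = OfType (proj₁ T)} {_∼_ = _≋_ G on proj₁}
    classes class (λ {((x , _) , _)} {((y , _) , _)} → ⟨⟩-cong {x = x} {y}) fibre
    where
    class : Elements (proj₁ T) → OfType (proj₁ T)
    class ((x , x∈G) , xT) = ofType T x x∈G xT , xT

    Fibre : OfType (proj₁ T) → Set
    Fibre (y , _) = Σ (Elements (proj₁ T)) λ ((x , _) , _) → ⟨ x ⟩ ≐ ⟨ perm y ⟩

    fibre : ∀ b → Card {Fibre b} (_≈ᴱ_ on proj₁) (φ (order (proj₁ T)))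
    fibre (y , yT) = card-map {A = Σ (Permutation′ n) λ χ → ⟨ χ ⟩ ≐ ⟨ perm y ⟩} {B = Fibre (y , yT)}
      {_≈_ = Perm._≈_ on proj₁} {_∼_ = _≈ᴱ_ on proj₁}
      (card-generators (perm y) {{order-nonZero (types-nonZero G T)}} (hasType-order (perm y) yT))
      (λ (((x , _) , _) , x≐y) → x , x≐y) (λ p → p) (λ p → p)
      λ (χ , χ≐y) → (((χ , generated χ χ≐y) , hasType-≐ χ (perm y) χ≐y yT) , χ≐y) , λ _ → refl
      where
      generated : ∀ χ → ⟨ χ ⟩ ≐ ⟨ perm y ⟩ → member χ
      generated χ (χ⊆y , _) = let a , eq = ⟨⟩-natural {x = perm y} {χ} (χ⊆y {χ} (∈⟨⟩-self χ)) in
        resp-≈ {a · perm y} {χ} (λ i → sym (eq i)) (member-· a (perm y) (proj₂ (proj₁ y)))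

  -- The elements of type `T` are counted directly and, by `card-elements` and `card-classes`,
  -- through their classes and components.
  μ≡ : ∀ T C → ContainsType G C (proj₁ T) →
       μ G (proj₁ T) ≡ componentCount T * (φ (order (proj₁ T)) * k G C (proj₁ T))
  μ≡ T C (x , C~x , xT) = trans
    (card-unique (card-μ (proj₁ T)) (card-elements T
      (card-classes T C (x , quotient⇒~ C x C~x , hasType⁺ x xT))))
    (trans (ℕ.*-assoc (componentCount T) (k G C (proj₁ T)) (φ (order (proj₁ T))))
      (cong (componentCount T *_) (ℕ.*-comm (k G C (proj₁ T)) (φ (order (proj₁ T))))))

  -- The components of the power graph are sorted by the unique `i` for which `T i` is joined to the
  -- types occurring in them.
  c₀≡ : ∀ {m} (T : Fin m → 𝒯₀ G) → (∀ i j → T i ~𝒯 T j → i ≡ j) → (∀ U → ∃ λ i → T i ~𝒯 U) →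
        c₀ G ≡ ℕΣ.sum (λ i → componentCount (T i))
  c₀≡ {m} T distinct covers = card-unique {_≈_ = _~_} (card-∣∣ (Graph.components P₀))
    (card-Σ {_≈_ = _~_} block block-cong (λ i → componentCount (T i)) fibre)
    where
    block : G₀ G → Fin m
    block x = proj₁ (covers (τ x))

    block-unique : ∀ {i} x → T i ~𝒯 τ x → block x ≡ i
    block-unique x p = distinct _ _ (P₀𝒯.trans (proj₂ (covers (τ x))) (P₀𝒯.sym p))

    block-cong : ∀ {x y} → x ~ y → block x ≡ block y
    block-cong {x} {y} x~y = block-unique x (P₀𝒯.trans (proj₂ (covers (τ y))) (P₀𝒯.sym (~⇒~𝒯 x y x~y)))

    fibre : ∀ i → Card {Σ (G₀ G) λ x → block x ≡ i} (_~_ on proj₁) (componentCount (T i))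
    fibre i = card-map {A = Over (T i)} {B = Σ (G₀ G) λ x → block x ≡ i} {_≈_ = _~_ on proj₁} {_∼_ = _~_ on proj₁}
      (card-over (T i))
      (λ (x , eq) → x , subst (λ j → T j ~𝒯 τ x) eq (proj₂ (covers (τ x)))) (λ p → p) (λ p → p)
      λ (x , p) → (x , block-unique x p) , P₀.refl

-- From natural numbers to rationals

+-/1 : ∀ a b → + (a ℕ.+ b) / 1 ≡ + a / 1 ℚ.+ + b / 1
-- For unnormalised fractions there is no reduction to lowest terms, and an identity of integers
-- over the denominator 1 remains.
+-/1 a b = ℚ.toℚᵘ-injective (begin
  ℚ.toℚᵘ (+ (a ℕ.+ b) / 1)                ≈⟨ ℚ.toℚᵘ-fromℚᵘ (ℚᵘ.mkℚᵘ (+ (a ℕ.+ b)) 0) ⟩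
  ℚᵘ.mkℚᵘ (+ (a ℕ.+ b)) 0                 ≈⟨ ℚᵘ.*≡* (cong (ℤ._* + 1) (sym (cong₂ ℤ._+_ (ℤ.*-identityʳ (+ a)) (ℤ.*-identityʳ (+ b))))) ⟩
  ℚᵘ.mkℚᵘ (+ a) 0 ℚᵘ.+ ℚᵘ.mkℚᵘ (+ b) 0     ≈⟨ ℚᵘ.+-cong (ℚ.toℚᵘ-fromℚᵘ (ℚᵘ.mkℚᵘ (+ a) 0)) (ℚ.toℚᵘ-fromℚᵘ (ℚᵘ.mkℚᵘ (+ b) 0)) ⟨
  ℚ.toℚᵘ (+ a / 1) ℚᵘ.+ ℚ.toℚᵘ (+ b / 1)  ≈⟨ ℚ.toℚᵘ-homo-+ (+ a / 1) (+ b / 1) ⟨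
  ℚ.toℚᵘ (+ a / 1 ℚ.+ + b / 1)            ∎)
  where open ℚᵘ.≃-Reasoning

sum-/1 : ∀ {m} (f : Fin m → ℕ) → + ℕΣ.sum f / 1 ≡ sum (λ i → + f i / 1)
sum-/1 {zero}  f = refl
sum-/1 {suc m} f = trans (+-/1 (f zero) (ℕΣ.sum (f ∘ suc))) (cong (+ f zero / 1 ℚ.+_) (sum-/1 (f ∘ suc)))

cancel-/ : ∀ {c} a d .{{_ : NonZero d}} → c ≡ a * d → + c / d ≡ + a / 1
-- `mkℚᵘ` stores the denominator minus one: `d` stands for `suc d` and 0 for 1. The hypothesis is
-- then the cross-multiplied equation.
cancel-/ {c} a (suc d) eq = ℚ.fromℚᵘ-cong {ℚᵘ.mkℚᵘ (+ c) d} {ℚᵘ.mkℚᵘ (+ a) 0}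
  (ℚᵘ.*≡* (trans (ℤ.*-identityʳ (+ c)) (trans (cong +_ eq) (ℤ.pos-* a (suc d)))))

theoremA : (n : ℕ) → 2 ≤ n →
    (G : Subgroup n) → FusionControlled G →
    (T : Fin (c₀𝒯 G) → 𝒯₀ G) →
    (∀ i j → Graph.Connected (properPowerTypeGraph G) (T i) (T j) → i ≡ j) →
    (∀ U → ∃ λ i → Graph.Connected (properPowerTypeGraph G) (T i) U) →
    (C : Fin (c₀𝒯 G) → Component G) →
    (C∋T : ∀ i → ContainsType G (C i) (proj₁ (T i))) →
    + c₀ G / 1 ≡
    sum (λ i → _/_ (+ μ G (proj₁ (T i)))
    (φ (order (proj₁ (T i))) * k G (C i) (proj₁ (T i)))
    {{denominator-nonZero G (T i) (C i) (C∋T i)}})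
theoremA n _ G fusion T distinct covers C C∋T = trans
  (cong (λ c → + c / 1) (c₀≡ G fusion T distinct covers))
  (trans (sum-/1 count) (sum-cong-≗ λ i → sym (cancel-/ (count i)
    (φ (order (proj₁ (T i))) * k G (C i) (proj₁ (T i)))
    {{denominator-nonZero G (T i) (C i) (C∋T i)}} (μ≡ G fusion (T i) (C i) (C∋T i)))))
  where
  count : Fin (c₀𝒯 G) → ℕ
  count i = componentCount G fusion (T i)
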